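{- Let $K_4$ be the complete graph on $4$ vertices. Then $K_4\notin\mathfrak{F}$, but $K_4\in\mathcal{P}$.
   Context: Graphs are finite, simple and undirected. $\mathbb{T}=\{z\in\mathbb{C}:|z|=1\}$, $\mathbb{I}=[0,2\pi)$. A $\mathbb{T}$-gain on $G$ is a map $\varphi$ from oriented edges to $\mathbb{T}$ with $\varphi(\overrightarrow{e_{ts}})=\varphi(\overrightarrow{e_{st}})^{ -1}$; $A(\Phi)$ for $\Phi=(G,\varphi)$ is the Hermitian matrix with $(s,t)$ entry $\varphi(\overrightarrow{e_{st}})$ if $v_s\sim v_t$, else $0$; $\mathcal{T}_G$ is the set of all $\mathbb{T}$-gain graphs on $G$. $\Re(A)\ge0$ means the real part of every entry of $A$ is nonnegative. The gain of a directed cycle is the product of gains of its oriented edges. A rooted spanning tree $T$ with root $v_r$ induces the tree order ($v_x\le v_y$ iff $v_x$ is on the $T$-path from $v_r$ to $v_y$); $T$ is normal if adjacent vertices of $G$ are always comparable. The suitably oriented graph $\overrightarrow{G_T}$ orients each edge $e_{st}$ with $v_s\le v_t$ as $\overrightarrow{e_{st}}$ if $e_{st}\in E(T)$ and as $\overrightarrow{e_{ts}}$ otherwise; the $m-n+1$ fundamental cycles $C_j$ of $T$ become directed cycles $\overrightarrow{C_j(T)}$. For $r=(c_1,\dots,c_{m-n+1})\in\mathbb{I}^{m-n+1}$, $\mathcal{A}_T(r)=\{(G,\varphi)\in\mathcal{T}_G:\varphi(\overrightarrow{C_j(T)})=e^{ic_j}\ \forall j\}$. $G$ has property GNRP (w.r.t.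 normal spanning tree $T$) if for each $r$ there is $\Phi\in\mathcal{A}_T(r)$ with $\Re(A(\Phi))\ge0$; $\mathcal{P}$ is the class of connected graphs with GNRP. The sum of subgraphs is the subgraph consisting of all edges in at least one of them. A fundamental subgraph of $G$ w.r.t. $T$ is the sum of a maximal collection of fundamental cycles whose sum intersects $T$ in a subtree. A fundamental subgraph built from fundamental cycles $C_1,\dots,C_s$ has DEP if they can be ordered $C_{k_1},\dots,C_{k_s}$ with $|E(C_{k_i})\setminus E(C_{k_1}+\cdots+C_{k_{i-1}})|>1$ for $i=2,\dots,s$. A connected graph has DEP if every fundamental subgraph with respect to a normal spanning tree $T$ has DEP; $\mathfrak{F}$ is the collection of connected graphs with DEP. -}

module Defs where

open import Algebra.Bundles using (CommutativeRing; RawSemiring; Semiring)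
import Algebra.Definitions.RawSemiring as SemiringDefs
open import Data.Bool using (if_then_else_)
open import Data.Fin using (Fin; _<_)
open import Data.Fin.Patterns using (0F; 1F; 2F; 3F; 4F; 5F)
open import Data.Fin.Properties using (any?; all?; _<?_) renaming (_≟_ to _≟ᶠ_)
open import Data.Fin.Subset
  using (Subset; _∈_; _∉_; _⊆_; _∪_; _∩_; _─_; ∁; ⊥; ⊤; ⋃; ⁅_⁆; ∣_∣)
open import Data.Fin.Subset.Properties using (_∈?_)
open import Data.List using (List; []; _∷_; _++_; map; filter; allFin; length)
import Data.List.Membership.Propositional as List
open import Data.List.Relation.Unary.Unique.Propositional using (Unique)
open import Data.Nat as ℕ using (ℕ; _!)
open import Data.Product using (Σ; ∃; ∃-syntax; _×_; _,_; proj₁; proj₂)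
open import Data.Product.Properties using (≡-dec)
open import Data.Sum using (_⊎_)
open import Function.Bundles using (_⇔_)
open import Function.Definitions using (Injective)
open import Level using (0ℓ)
open import Relation.Binary using (Rel; IsTotalOrder; Decidable)
import Relation.Binary.Construct.NonStrictToStrict as Strict
open import Relation.Binary.Construct.Closure.ReflexiveTransitive
  using (Star; ε; _◅_)
open import Relation.Binary.PropositionalEquality using (_≡_; _≢_)
open import Relation.Nullary using (¬_; does)
open import Relation.Nullary.Decidable using (toWitness; _⊎-dec_; _→-dec_)

------------------------------------------------------------------------
-- Graphs

-- A finite simple undirected graph: the vertices are Fin n, the edges are
-- Fin m, and the edge e is the two-element set {u , v} where
-- ends e = (u , v) and u < v.  Distinct edges have distinct ends.

record Graph : Set where
  field
    n m     : ℕ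
    ends    : Fin m → Fin n × Fin n
    ordered : ∀ e → proj₁ (ends e) < proj₂ (ends e)
    simple  : Injective _≡_ _≡_ ends

  Joins : Fin m → Rel (Fin n) 0ℓ
  Joins e u v = ends e ≡ (u , v) ⊎ ends e ≡ (v , u)

  _∼_ : Rel (Fin n) 0ℓ
  u ∼ v = ∃[ e ] Joins e u v

  _∼?_ : Decidable _∼_
  u ∼? v = any? λ e → ≡-dec _≟ᶠ_ _≟ᶠ_ (ends e) (u , v)
                 ⊎-dec ≡-dec _≟ᶠ_ _≟ᶠ_ (ends e) (v , u)

-- Subgraphs are given by their edge sets, their vertices being the ends of
-- these edges (for a spanning subgraph: all vertices of the graph).

module _ (G : Graph) where
  open Graph G

  Step : Subset m → Rel (Fin n) 0ℓ
  Step H u v = ∃[ e ] (e ∈ H × Joins e u v)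

  Walk : Subset m → Rel (Fin n) 0ℓ
  Walk H = Star (Step H)

  vertices : ∀ {H u v} → Walk H u v → List (Fin n)
  vertices {u = u} ε       = u ∷ []
  vertices {u = u} (_ ◅ w) = u ∷ vertices w

  edges : ∀ {H u v} → Walk H u v → Subset m
  edges ε             = ⊥
  edges ((e , _) ◅ w) = ⁅ e ⁆ ∪ edges w

  Path : Subset m → Rel (Fin n) 0ℓ
  Path H u v = Σ (Walk H u v) λ w → Unique (vertices w)

  Connected : Set
  Connected = ∀ u v → Path ⊤ u v

  -- A cycle is a path on at least three vertices together with an edge
  -- joining its last vertex to its first.
  Acyclic : Subset m → Set
  Acyclic H = ∀ {u v} (p : Path H u v) →
              3 ℕ.≤ length (vertices (proj₁ p)) → ¬ Step H v u

  VertexOf : Subset m → Fin n → Set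
  VertexOf H v = ∃[ w ] Step H v w

  IsTree : Subset m → Set
  IsTree H = (∀ u v → VertexOf H u → VertexOf H v → Path H u v) × Acyclic H

  record NormalSpanningTree : Set where
    field
      T       : Subset m
      path    : ∀ u v → Path T u v
      acyclic : Acyclic T
      root    : Fin n

    -- u ≼ v iff u lies on the tree path from the root to v.
    _≼_ : Rel (Fin n) 0ℓ
    u ≼ v = u List.∈ vertices (proj₁ (path root v))

    field
      normal  : ∀ u v → u ∼ v → u ≼ v ⊎ v ≼ u

------------------------------------------------------------------------
-- Fundamental cycles, fundamental subgraphs and DEP

module _ {G : Graph} (𝒯 : NormalSpanningTree G) where
  open Graph G
  open NormalSpanningTree 𝒯

  -- The edge set of the fundamental cycle of a non-tree edge e.  The
  -- fundamental cycles are indexed by the non-tree edges, and a collection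
  -- of them is a set J ⊆ ∁ T.
  fundamentalCycle : Fin m → Subset m
  fundamentalCycle e =
    ⁅ e ⁆ ∪ edges G (proj₁ (path (proj₁ (ends e)) (proj₂ (ends e))))

  sumOf : List (Fin m) → Subset m
  sumOf es = ⋃ (map fundamentalCycle es)

  MeetsInSubtree : Subset m → Set
  MeetsInSubtree J = IsTree G (sumOf (filter (_∈? J) (allFin m)) ∩ T)

  -- The collections J of fundamental cycles whose sums are the fundamental
  -- subgraphs.
  IsFundamental : Subset m → Set
  IsFundamental J =
    J ⊆ ∁ T × MeetsInSubtree J ×
    (∀ J′ → J′ ⊆ ∁ T → MeetsInSubtree J′ → J ⊆ J′ → J′ ⊆ J)

  -- ks is an ordering of J; the condition on a splitting ks = xs ++ k ∷ ys
  -- with xs nonempty is the one on the i-th cycle, i = 1 + length xs ≥ 2.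
  SubgraphDEP : Subset m → Set
  SubgraphDEP J = ∃[ ks ]
    Unique ks × (∀ e → e List.∈ ks ⇔ e ∈ J) ×
    (∀ xs k ys → ks ≡ xs ++ k ∷ ys → xs ≢ [] →
       ∣ fundamentalCycle k ─ sumOf xs ∣ ℕ.> 1)

  DEP : Set
  DEP = ∀ J → IsFundamental J → SubgraphDEP J

𝔉 : Graph → Set
𝔉 G = Connected G × ∃[ 𝒯 ] DEP {G} 𝒯

------------------------------------------------------------------------
-- Real and complex numbers

-- The real numbers, axiomatised as a Dedekind-complete totally ordered
-- field; classically this determines them up to isomorphism.  The supremum
-- is taken in the form "an upper bound s such that every y < s is exceeded
-- by an element of S".  As S is an arbitrary predicate, completeness in this
-- form together with totality of the order implies excluded middle for Set,
-- so the reals here are the classical ones.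

record RealNumbers : Set₁ where
  infix  8 _⁻¹
  infix  4 _≤_
  field
    commutativeRing : CommutativeRing 0ℓ 0ℓ

  open CommutativeRing commutativeRing public renaming (Carrier to ℝ)

  field
    _≤_          : Rel ℝ 0ℓ
    isTotalOrder : IsTotalOrder _≈_ _≤_
    +-monoʳ-≤    : ∀ x {y z} → y ≤ z → x + y ≤ x + z
    *-nonneg     : ∀ {x y} → 0# ≤ x → 0# ≤ y → 0# ≤ x * y
    0≉1          : ¬ 0# ≈ 1#
    -- The value of 0# ⁻¹ is unspecified.
    _⁻¹          : ℝ → ℝ
    *-inverseʳ   : ∀ x → ¬ x ≈ 0# → x * x ⁻¹ ≈ 1#

  open Strict _≈_ _≤_ public using () renaming (_<_ to _<ʳ_)

  field
    supremum : (S : ℝ → Set) → ∃ S → (∃[ b ] ∀ x → S x → x ≤ b) →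
               ∃[ s ] ((∀ x → S x → x ≤ s) ×
                       (∀ y → y <ʳ s → ∃[ x ] (S x × y <ʳ x)))

module Complex (𝓡 : RealNumbers) where
  open RealNumbers 𝓡
  open SemiringDefs (Semiring.rawSemiring semiring) using () renaming (_×_ to _×ʳ_)

  infix  4 _≈ᶜ_
  infix  5 _+i_
  infixl 6 _+ᶜ_ _-ᶜ_
  infixl 7 _*ᶜ_

  record ℂ : Set where
    constructor _+i_
    field
      Re Im : ℝ
  open ℂ public

  _≈ᶜ_ : Rel ℂ 0ℓ
  z ≈ᶜ w = Re z ≈ Re w × Im z ≈ Im w

  0ᶜ 1ᶜ : ℂ
  0ᶜ = 0# +i 0#
  1ᶜ = 1# +i 0#

  _+ᶜ_ _-ᶜ_ _*ᶜ_ : ℂ → ℂ → ℂ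
  z +ᶜ w = (Re z + Re w) +i (Im z + Im w)
  z -ᶜ w = (Re z - Re w) +i (Im z - Im w)
  z *ᶜ w = (Re z * Re w - Im z * Im w) +i (Re z * Im w + Im z * Re w)

  ℂ-rawSemiring : RawSemiring 0ℓ 0ℓ
  ℂ-rawSemiring = record
    { Carrier = ℂ ; _≈_ = _≈ᶜ_ ; _+_ = _+ᶜ_ ; _*_ = _*ᶜ_ ; 0# = 0ᶜ ; 1# = 1ᶜ }

  open SemiringDefs ℂ-rawSemiring using (_^_)

  ∣_∣² : ℂ → ℝ
  ∣ z ∣² = Re z * Re z + Im z * Im z

  -- |z| = 1
  𝕋 : ℂ → Set
  𝕋 z = ∣ z ∣² ≈ 1#

  -- For every ε > 0, |aₖ - z| < ε for all large enough k; squared to avoid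
  -- square roots.
  _⟶_ : (ℕ → ℂ) → ℂ → Set
  a ⟶ z = ∀ ε → 0# <ʳ ε →
    ∃[ N ] ∀ k → N ℕ.≤ k → ∣ a k -ᶜ z ∣² <ʳ ε * ε

  -- The sum of zᵏ / k! over k < N.
  expSum : ℂ → ℕ → ℂ
  expSum z ℕ.zero    = 0ᶜ
  expSum z (ℕ.suc k) = expSum z k +ᶜ (((k !) ×ʳ 1#) ⁻¹ +i 0#) *ᶜ z ^ k

  -- z = e^{iθ}
  _≈e^i_ : ℂ → ℝ → Set
  z ≈e^i θ = expSum (0# +i θ) ⟶ z

  -- sin θ = 0
  SinZero : ℝ → Set
  SinZero θ = ∃[ z ] (z ≈e^i θ × Im z ≈ 0#)

  -- π is the least positive zero of the sine function.
  IsPi : ℝ → Set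
  IsPi p = 0# <ʳ p × SinZero p × (∀ t → 0# <ʳ t → t <ʳ p → ¬ SinZero t)

  -- The interval [0, 2π).
  𝕀 : ℝ → Set
  𝕀 c = 0# ≤ c × ∃[ p ] (IsPi p × c <ʳ p + p)

------------------------------------------------------------------------
-- 𝕋-gain graphs and GNRP

module _ (𝓡 : RealNumbers) where
  open RealNumbers 𝓡 using (ℝ; 0#; _≤_)
  open Complex 𝓡

  -- φ u v is the gain of the edge uv oriented from u to v; its values at
  -- nonadjacent pairs are irrelevant.
  record Gain (G : Graph) : Set where
    open Graph G
    field
      φ       : Fin n → Fin n → ℂ
      unit    : ∀ {u v} → u ∼ v → 𝕋 (φ u v)
      inverse : ∀ {u v} → u ∼ v → φ v u *ᶜ φ u v ≈ᶜ 1ᶜ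

  module _ {G : Graph} (Φ : Gain G) where
    open Graph G
    open Gain Φ

    adjacencyMatrix : Fin n → Fin n → ℂ
    adjacencyMatrix u v = if does (u ∼? v) then φ u v else 0ᶜ

    walkGain : ∀ {H u v} → Walk G H u v → ℂ
    walkGain ε                           = 1ᶜ
    walkGain {u = u} (_◅_ {j = j} _ w) = φ u j *ᶜ walkGain w

  module _ {G : Graph} (𝒯 : NormalSpanningTree G) where
    open Graph G
    open NormalSpanningTree 𝒯

    -- Membership in 𝒜_T(r).  The angles are indexed by the non-tree edges,
    -- the values of r on T being irrelevant.  If s ≼ t are the ends of a
    -- non-tree edge, then in the suitably oriented graph the tree edges of
    -- its fundamental cycle are directed along the tree path from s to t,
    -- away from the root, and the non-tree edge is directed from t back to s.
    _∈𝒜_ : Gain G → (Fin m → ℝ) → Set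
    Φ ∈𝒜 r = ∀ e → e ∉ T → ∀ s t → Joins e s t → s ≼ t →
      (walkGain Φ (proj₁ (path s t)) *ᶜ Gain.φ Φ t s) ≈e^i r e

    GNRP : Set
    GNRP = ∀ (r : Fin m → ℝ) → (∀ e → e ∉ T → 𝕀 (r e)) →
      ∃[ Φ ] (Φ ∈𝒜 r × (∀ u v → 0# ≤ Re (adjacencyMatrix Φ u v)))

  -- The existence of a suitable gain for every r does not depend on 𝒯: as r
  -- varies, the sets 𝒜_T(r) are exactly the switching classes on G.
  𝒫 : Graph → Set
  𝒫 G = Connected G × ∃[ 𝒯 ] GNRP {G} 𝒯

------------------------------------------------------------------------
-- The complete graph on four vertices

K₄ : Graph
K₄ = record { n = 4 ; m = 6 ; ends = ends ; ordered = ordered ; simple = simple }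
  where
  ends : Fin 6 → Fin 4 × Fin 4
  ends 0F = 0F , 1F
  ends 1F = 0F , 2F
  ends 2F = 0F , 3F
  ends 3F = 1F , 2F
  ends 4F = 1F , 3F
  ends 5F = 2F , 3F

  ordered : ∀ e → proj₁ (ends e) < proj₂ (ends e)
  ordered = toWitness {a? = all? λ e → proj₁ (ends e) <? proj₂ (ends e)} _

  simple : Injective _≡_ _≡_ ends
  simple {d} {e} = toWitness {a? = all? λ d → all? λ e →
    ≡-dec _≟ᶠ_ _≟ᶠ_ (ends d) (ends e) →-dec (d ≟ᶠ e)} _ d e

{-# OPTIONS --safe #-}
module Submission where

open import Algebra.Bundles using (CommutativeRing; RawRing; Semiring)
import Algebra.Definitions.RawSemiring as SemiringDefs
import Algebra.Properties.Ring as RingProperties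
import Algebra.Properties.Semiring.Mult as Mult
import Algebra.Solver.Ring as RingSolver
open import Algebra.Solver.Ring.AlmostCommutativeRing
  using (_-Raw-AlmostCommutative⟶_; fromCommutativeRing)
open import Data.Bool using (true; false)
open import Data.Fin using (Fin; _<_; toℕ; opposite)
open import Data.Fin.Patterns using (0F; 1F; 2F; 3F; 4F; 5F)
open import Data.Fin.Properties
  using (all?; <⇒≢; <-asym; toℕ-injective; opposite-involutive) renaming (_≟_ to _≟ᶠ_)
open import Data.Fin.Subset
  using (Subset; inside; outside; _∈_; _∉_; _⊆_; _∪_; _∩_; _─_; ∁; ⊤; ⋃; ⁅_⁆; ∣_∣)
open import Data.Fin.Subset.Properties
  using (_∈?_; _⊆?_; anySubset?; ⊆⊤; ⊆-antisym; p⊆q⇒∣p∣≤∣q∣; ∣p∣≤n; ∣⊥∣≡0; ∣⁅x⁆∣≡1; ∣∁p∣≡n∸∣p∣;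
         x∈⁅x⁆; x∈⁅y⁆⇒x≡y; x∈∁p⇒x∉p; x∉p⇒x∈∁p; x∈p∪q⁺; ∪-identityʳ; p∩q⊆p; p∩q⊆q; x∈p∩q⁺; x∈p∩q⁻;
         p─q⊆p; x∈p⇒∣p-x∣<∣p∣; x∈p∧x≢y⇒x∈p-y)
open import Data.List using (List; []; _∷_; _++_; map; filter; allFin; length)
import Data.List.Membership.DecPropositional as DecMembership
import Data.List.Membership.Propositional as List
open import Data.List.Membership.Propositional.Properties using (∈-filter⁺; ∈-allFin)
open import Data.List.Relation.Unary.All as All using (All; []; _∷_)
open import Data.List.Relation.Unary.All.Properties using (¬Any⇒All¬)
open import Data.List.Relation.Unary.AllPairs using ([]; _∷_)
open import Data.List.Relation.Unary.Any as Any using (Any; here; there)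
open import Data.List.Relation.Unary.Unique.DecPropositional using (unique?)
open import Data.List.Relation.Unary.Unique.Propositional using (Unique)
open import Data.Maybe using (just; nothing)
open import Data.Nat as ℕ using (ℕ; zero; suc; z≤n; s≤s; _!)
import Data.Nat.Properties as ℕ
open import Data.Product using (∃-syntax; _×_; _,_; proj₁; proj₂)
open import Data.Product.Properties using (,-injectiveˡ; ,-injectiveʳ; ≡-dec)
open import Data.Sum as Sum using (_⊎_; inj₁; inj₂; [_,_]′; swap)
open import Data.Vec using ([]; _∷_; here; there)
open import Function using (_∘_; id)
open import Function.Bundles using (Equivalence)
open import Function.Definitions using (Injective)
open import Level using (0ℓ)
open import Relation.Binary using (IsTotalOrder; WeaklyDecidable)
open import Relation.Binary.Construct.Closure.ReflexiveTransitive using (ε; _◅_; _◅◅_; reverse)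
import Relation.Binary.PropositionalEquality as ≡
open ≡ using (_≡_; _≢_)
import Relation.Binary.Reasoning.Setoid as SetoidReasoning
open import Relation.Nullary using (¬_; Dec; yes; no; does; contradiction)
open import Relation.Nullary.Decidable using (True; toWitness; _×-dec_; _⊎-dec_; _→-dec_; ¬?)
open import Defs

-- K₄ ∉ 𝔉: for any spanning tree T, all three fundamental cycles together
-- contain T, as K₄ has no bridge, so they form a fundamental subgraph.  An
-- ordering as in DEP would exhibit at least 3 + 2 + 2 edges, but there are 6.
--
-- K₄ ∈ 𝒫: let T be the path v₀v₁v₂v₃, and let A, B and C be the prescribed
-- gains of the fundamental cycles of v₀v₂, v₁v₃ and v₀v₃.  Give the tree edges
-- the gains x = ± C B̄, y = ± i and z = ± i C (x y)‾, which leaves A (x y)‾,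
-- B (y z)‾ and C (x y z)‾ for the other edges.  Up to sign, the last two are i
-- whatever the signs in x, y and z.  The real part of y also vanishes, and the
-- signs are chosen one after the other to make the real parts of x,
-- A (x y)‾ and z nonnegative.
--
-- That e^{iθ} exists follows from nested intervals, the partial sums of its
-- series forming a Cauchy sequence with geometric rate, and |e^{iθ}| = 1 from the
-- Cauchy product of the series for iθ and −iθ.

-- Fundamental cycles and DEP

-- The choice of gains comes from splitting the edges of K₄ into two spanning paths, v₂v₁v₃v₀ and
-- v₁v₀v₂v₃. Switching can prescribe the gains on the first path, and ± i is prescribed there
-- because its real part is zero for either sign. Switching by ± 1 keeps this, and since the second
-- path is a spanning tree as well, it adjusts the signs of the real parts there independently. The
-- formula for x is then forced: C (x y z)‾ and B (y z)‾ differ by the factor C B̄ x̄, which has to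
-- be real.

∣p∪q∣≡∣p∣+∣q─p∣ : ∀ {n} (p q : Subset n) → ∣ p ∪ q ∣ ≡ ∣ p ∣ ℕ.+ ∣ q ─ p ∣
∣p∪q∣≡∣p∣+∣q─p∣ []          []          = ≡.refl
∣p∪q∣≡∣p∣+∣q─p∣ (true  ∷ p) (_     ∷ q) = ≡.cong suc (∣p∪q∣≡∣p∣+∣q─p∣ p q)
∣p∪q∣≡∣p∣+∣q─p∣ (false ∷ p) (false ∷ q) = ∣p∪q∣≡∣p∣+∣q─p∣ p q
∣p∪q∣≡∣p∣+∣q─p∣ (false ∷ p) (true  ∷ q) =
  ≡.trans (≡.cong suc (∣p∪q∣≡∣p∣+∣q─p∣ p q)) (≡.sym (ℕ.+-suc ∣ p ∣ ∣ q ─ p ∣))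

∣p∪q∣≤∣p∣+∣q∣ : ∀ {n} (p q : Subset n) → ∣ p ∪ q ∣ ℕ.≤ ∣ p ∣ ℕ.+ ∣ q ∣
∣p∪q∣≤∣p∣+∣q∣ p q = ℕ.≤-trans (ℕ.≤-reflexive (∣p∪q∣≡∣p∣+∣q─p∣ p q))
                              (ℕ.+-monoʳ-≤ ∣ p ∣ (p⊆q⇒∣p∣≤∣q∣ (p─q⊆p q p)))

unique⇒length≤∣p∣ : ∀ {n} {xs : List (Fin n)} {p} → Unique xs → All (_∈ p) xs →
                    length xs ℕ.≤ ∣ p ∣
unique⇒length≤∣p∣ [] [] = z≤n
unique⇒length≤∣p∣ (x≢xs ∷ xs!) (x∈p ∷ xs∈p) =
  ℕ.≤-trans (s≤s (unique⇒length≤∣p∣ xs!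
    (All.zipWith (λ (x≢y , y∈p) → x∈p∧x≢y⇒x∈p-y y∈p (x≢y ∘ ≡.sym)) (x≢xs , xs∈p))))
    (x∈p⇒∣p-x∣<∣p∣ x∈p)

covered⇒∣p∣≤length : ∀ {n} (xs : List (Fin n)) {p} → (∀ {x} → x ∈ p → x List.∈ xs) →
                     ∣ p ∣ ℕ.≤ length xs
covered⇒∣p∣≤length {n} xs cover =
  ℕ.≤-trans (p⊆q⇒∣p∣≤∣q∣ (λ x∈p → ∈-singletons (cover x∈p))) (∣singletons∣ xs)
  where
  ∈-singletons : ∀ {x xs} → x List.∈ xs → x ∈ ⋃ (map ⁅_⁆ xs)
  ∈-singletons (here ≡.refl)  = x∈p∪q⁺ (inj₁ (x∈⁅x⁆ _))
  ∈-singletons (there x∈xs) = x∈p∪q⁺ (inj₂ (∈-singletons x∈xs))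

  ∣singletons∣ : ∀ (xs : List (Fin n)) → ∣ ⋃ (map ⁅_⁆ xs) ∣ ℕ.≤ length xs
  ∣singletons∣ []       = ℕ.≤-reflexive (∣⊥∣≡0 n)
  ∣singletons∣ (x ∷ xs) = ℕ.≤-trans (∣p∪q∣≤∣p∣+∣q∣ ⁅ x ⁆ _)
    (ℕ.+-mono-≤ (ℕ.≤-reflexive (∣⁅x⁆∣≡1 x)) (∣singletons∣ xs))

module _ {G : Graph} where
  open Graph G

  Joins-irrefl : ∀ {e u v} → Joins e u v → u ≢ v
  Joins-irrefl {e} j ≡.refl =
    <⇒≢ (ordered e) (≡.trans (≡.cong proj₁ loop) (≡.sym (≡.cong proj₂ loop)))
    where loop = [ id , id ]′ j

  Joins-unique : ∀ {e f u v} → Joins e u v → Joins f u v → e ≡ f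
  Joins-unique (inj₁ p) (inj₁ q) = simple (≡.trans p (≡.sym q))
  Joins-unique (inj₂ p) (inj₂ q) = simple (≡.trans p (≡.sym q))
  Joins-unique {e} {f} (inj₁ p) (inj₂ q) = contradiction
    (≡.subst (λ x → proj₁ x < proj₂ x) q (ordered f))
    (<-asym (≡.subst (λ x → proj₁ x < proj₂ x) p (ordered e)))
  Joins-unique {e} {f} (inj₂ p) (inj₁ q) = ≡.sym (Joins-unique {f} {e} (inj₁ q) (inj₂ p))

  Joins-functional : ∀ {e u v w} → Joins e u v → Joins e u w → v ≡ w
  Joins-functional (inj₁ p) (inj₁ q) = ,-injectiveʳ (≡.trans (≡.sym p) q)
  Joins-functional (inj₂ p) (inj₂ q) = ,-injectiveˡ (≡.trans (≡.sym p) q)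
  Joins-functional (inj₁ p) (inj₂ q) =
    ≡.trans (,-injectiveʳ (≡.trans (≡.sym p) q)) (,-injectiveˡ (≡.trans (≡.sym p) q))
  Joins-functional (inj₂ p) (inj₁ q) = ≡.sym (Joins-functional (inj₁ q) (inj₂ p))

  Step-sym : ∀ {H u v} → Step G H u v → Step G H v u
  Step-sym (e , e∈H , j) = e , e∈H , swap j

  walk-⊆ : ∀ {H K u v} → H ⊆ K → Walk G H u v → Walk G K u v
  walk-⊆ H⊆K ε                   = ε
  walk-⊆ H⊆K ((e , e∈H , j) ◅ w) = (e , H⊆K e∈H , j) ◅ walk-⊆ H⊆K w

  vertices-walk-⊆ : ∀ {H K u v} (H⊆K : H ⊆ K) (w : Walk G H u v) →
                    vertices G (walk-⊆ H⊆K w) ≡ vertices G w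
  vertices-walk-⊆ H⊆K ε       = ≡.refl
  vertices-walk-⊆ H⊆K (_ ◅ w) = ≡.cong (_ ∷_) (vertices-walk-⊆ H⊆K w)

  walk-avoiding : ∀ {H e u v} (w : Walk G H u v) → e ∉ edges G w → Walk G (H ∩ ∁ ⁅ e ⁆) u v
  walk-avoiding ε _ = ε
  walk-avoiding ((f , f∈H , j) ◅ w) e∉ =
    (f , x∈p∩q⁺ (f∈H , x∉p⇒x∈∁p f∉⁅e⁆) , j) ◅ walk-avoiding w (e∉ ∘ x∈p∪q⁺ ∘ inj₂)
    where f∉⁅e⁆ = λ f∈ → e∉ (x∈p∪q⁺ (inj₁ (≡.subst (_∈ ⁅ f ⁆) (x∈⁅y⁆⇒x≡y _ f∈) (x∈⁅x⁆ f))))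

  tail-path : ∀ {H u v x} (w : Walk G H u v) → Unique (vertices G w) →
              x List.∈ vertices G w → Path G H x v
  tail-path ε       w!       (here ≡.refl) = ε , w!
  tail-path (s ◅ w) w!       (here ≡.refl) = s ◅ w , w!
  tail-path (s ◅ w) (_ ∷ w!) (there x∈w)   = tail-path w w! x∈w

  -- Loop erasure from the end: if the first vertex recurs on the path made from the rest of the
  -- walk, only the part from that recurrence on is kept.
  walk⇒path : ∀ {H u v} → Walk G H u v → Path G H u v
  walk⇒path ε = ε , [] ∷ []
  walk⇒path {u = u} (s ◅ w) with walk⇒path w
  ... | p , p! with DecMembership._∈?_ _≟ᶠ_ u (vertices G p)
  ...   | yes u∈p = tail-path p p! u∈p
  ...   | no  u∉p = s ◅ p , ¬Any⇒All¬ _ u∉p ∷ p!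

  start∈vertices : ∀ {H u v} (w : Walk G H u v) → u List.∈ vertices G w
  start∈vertices ε       = here ≡.refl
  start∈vertices (_ ◅ _) = here ≡.refl

  vertices-nonempty : ∀ {H u v} (w : Walk G H u v) → 1 ℕ.≤ length (vertices G w)
  vertices-nonempty ε       = s≤s z≤n
  vertices-nonempty (_ ◅ _) = s≤s z≤n

  -- Every edge of a forest is a bridge. A walk around `e` shortens to a path. This path is not
  -- trivial, as `e` is no loop; it is not a single edge, as that edge would be `e`; and a longer
  -- one is closed to a cycle by `e`.
  acyclic⇒no-bypass : ∀ {H e u v} → Acyclic G H → e ∈ H → Joins e u v → ¬ Walk G (H ∩ ∁ ⁅ e ⁆) u v
  acyclic⇒no-bypass {H} {e} acyclic e∈H j w with walk⇒path w
  ... | ε , _ = Joins-irrefl j ≡.refl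
  ... | (f , f∈ , k) ◅ ε , _ =
    x∈∁p⇒x∉p (proj₂ (x∈p∩q⁻ _ _ f∈)) (≡.subst (_∈ ⁅ e ⁆) (Joins-unique j k) (x∈⁅x⁆ e))
  ... | p@(_ ◅ _ ◅ q) , p! =
    acyclic (walk-⊆ H-e⊆H p , ≡.subst Unique (≡.sym same-vertices) p!)
      (≡.subst ((3 ℕ.≤_) ∘ length) (≡.sym same-vertices) (s≤s (s≤s (vertices-nonempty q))))
      (e , e∈H , swap j)
    where
    H-e⊆H = p∩q⊆p H (∁ ⁅ e ⁆)
    same-vertices = vertices-walk-⊆ H-e⊆H p

  -- Since `e` is neither a loop nor parallel to an edge of `H`, the path has at least two edges.
  -- The first two differ because a path does not turn back, and together with `e` they suffice.
  3≤∣cycle∣ : ∀ {H e u v} → e ∉ H → Joins e u v → (p : Path G H u v) →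
              3 ℕ.≤ ∣ ⁅ e ⁆ ∪ edges G (proj₁ p) ∣
  3≤∣cycle∣ e∉H j (ε , _) = contradiction ≡.refl (Joins-irrefl j)
  3≤∣cycle∣ e∉H j ((f , f∈H , k) ◅ ε , _) =
    contradiction (≡.subst (_∈ _) (Joins-unique k j) f∈H) e∉H
  3≤∣cycle∣ {H} {e} e∉H j ((f , f∈H , k) ◅ (g , g∈H , l) ◅ w , (_ ∷ u∉w) ∷ _) =
    unique⇒length≤∣p∣ {xs = e ∷ f ∷ g ∷ []}
      ((e≢ f∈H ∷ e≢ g∈H ∷ []) ∷ (f≢g ∷ []) ∷ [] ∷ [])
      ( x∈p∪q⁺ (inj₁ (x∈⁅x⁆ e))
      ∷ x∈p∪q⁺ (inj₂ (x∈p∪q⁺ (inj₁ (x∈⁅x⁆ f))))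
      ∷ x∈p∪q⁺ (inj₂ (x∈p∪q⁺ (inj₂ (x∈p∪q⁺ (inj₁ (x∈⁅x⁆ g)))))) ∷ [])
    where
    e≢ : ∀ {x} → x ∈ H → e ≢ x
    e≢ x∈H ≡.refl = e∉H x∈H
    f≢g : f ≢ g
    f≢g ≡.refl = All.lookup u∉w (start∈vertices w) (Joins-functional (swap k) l)

  module _ (𝒯 : NormalSpanningTree G) where
    open NormalSpanningTree 𝒯

    allCycles : Subset m
    allCycles = sumOf 𝒯 (filter (_∈? ∁ T) (allFin m))

    cycle⊆sumOf : ∀ {e es} → e List.∈ es → fundamentalCycle 𝒯 e ⊆ sumOf 𝒯 es
    cycle⊆sumOf (here ≡.refl)  = x∈p∪q⁺ ∘ inj₁
    cycle⊆sumOf (there e∈es) = x∈p∪q⁺ ∘ inj₂ ∘ cycle⊆sumOf e∈es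

    -- A tree edge other than `e` is its own detour. For a non-tree edge the rest of its fundamental
    -- cycle serves, and this misses `e`, which lies on no fundamental cycle.
    detour : ∀ {e f u v} → e ∉ allCycles → f ≢ e → Joins f u v → Walk G (T ∩ ∁ ⁅ e ⁆) u v
    detour {e} {f} e∉ f≢e j with f ∈? T
    ... | yes f∈T = (f , x∈p∩q⁺ (f∈T , x∉p⇒x∈∁p (f≢e ∘ x∈⁅y⁆⇒x≡y e)) , j) ◅ ε
    ... | no  f∉T = orient j
      where
      w = walk-avoiding (proj₁ (path (proj₁ (ends f)) (proj₂ (ends f)))) λ e∈ →
        e∉ (cycle⊆sumOf (∈-filter⁺ (_∈? ∁ T) (∈-allFin f) (x∉p⇒x∈∁p f∉T)) (x∈p∪q⁺ (inj₂ e∈)))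
      orient : ∀ {u v} → Joins f u v → Walk G (T ∩ ∁ ⁅ e ⁆) u v
      orient (inj₁ eq) = ≡.subst (λ (u , v) → Walk G _ u v) eq w
      orient (inj₂ eq) = reverse Step-sym (≡.subst (λ (u , v) → Walk G _ u v) eq w)

    -- Otherwise the detours of the two other sides would join the ends of `e` within the tree
    -- without using `e`, although `e` is a bridge of the tree.
    triangle⇒∈allCycles : ∀ {e f g u v w} → e ∈ T → Joins e u v →
      f ≢ e → Joins f u w → g ≢ e → Joins g w v → e ∈ allCycles
    triangle⇒∈allCycles {e} e∈T j f≢e k g≢e l with e ∈? allCycles
    ... | yes e∈ = e∈
    ... | no  e∉ = contradiction (detour e∉ f≢e k ◅◅ detour e∉ g≢e l)
                                 (acyclic⇒no-bypass acyclic e∈T j)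

    three-cycles⇒7≤m : ∀ k₁ k₂ k₃ → 3 ℕ.≤ ∣ fundamentalCycle 𝒯 k₁ ∣ →
      1 ℕ.< ∣ fundamentalCycle 𝒯 k₂ ─ sumOf 𝒯 (k₁ ∷ []) ∣ →
      1 ℕ.< ∣ fundamentalCycle 𝒯 k₃ ─ sumOf 𝒯 (k₁ ∷ k₂ ∷ []) ∣ → 7 ℕ.≤ m
    three-cycles⇒7≤m k₁ k₂ k₃ h₁ h₂ h₃ = begin
      3 ℕ.+ 2 ℕ.+ 2
        -- `sumOf` is a union that ends in the empty set, which `∪-identityʳ` removes.
        ≤⟨ ℕ.+-mono-≤ (ℕ.+-mono-≤ h₁
             (≡.subst (λ s → 1 ℕ.< ∣ C k₂ ─ s ∣) (∪-identityʳ (C k₁)) h₂))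
             (≡.subst (λ s → 1 ℕ.< ∣ C k₃ ─ s ∣) (≡.cong (C k₁ ∪_) (∪-identityʳ (C k₂))) h₃) ⟩
      ∣ C k₁ ∣ ℕ.+ ∣ C k₂ ─ C k₁ ∣ ℕ.+ ∣ C k₃ ─ (C k₁ ∪ C k₂) ∣
        ≡⟨ ≡.cong (ℕ._+ ∣ C k₃ ─ (C k₁ ∪ C k₂) ∣) (∣p∪q∣≡∣p∣+∣q─p∣ (C k₁) (C k₂)) ⟨
      ∣ C k₁ ∪ C k₂ ∣ ℕ.+ ∣ C k₃ ─ (C k₁ ∪ C k₂) ∣
        ≡⟨ ∣p∪q∣≡∣p∣+∣q─p∣ (C k₁ ∪ C k₂) (C k₃) ⟨
      ∣ (C k₁ ∪ C k₂) ∪ C k₃ ∣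
        ≤⟨ ∣p∣≤n ((C k₁ ∪ C k₂) ∪ C k₃) ⟩
      m ∎
      where
      open ℕ.≤-Reasoning
      C = fundamentalCycle 𝒯

    DEP⇒7≤m : ∀ {ks} → (∀ {e} → e List.∈ ks → e ∉ T) →
      (∀ xs k ys → ks ≡ xs ++ k ∷ ys → xs ≢ [] → ∣ fundamentalCycle 𝒯 k ─ sumOf 𝒯 xs ∣ ℕ.> 1) →
      3 ℕ.≤ length ks → 7 ℕ.≤ m
    DEP⇒7≤m {k₁ ∷ k₂ ∷ k₃ ∷ ks} ks∉T grow _ = three-cycles⇒7≤m k₁ k₂ k₃
      (3≤∣cycle∣ (ks∉T (here ≡.refl)) (inj₁ ≡.refl) (path _ _))
      (grow (k₁ ∷ []) k₂ (k₃ ∷ ks) ≡.refl λ ())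
      (grow (k₁ ∷ k₂ ∷ []) k₃ ks ≡.refl λ ())
    DEP⇒7≤m {[]} _ _ ()
    DEP⇒7≤m {_ ∷ []} _ _ (s≤s ())
    DEP⇒7≤m {_ ∷ _ ∷ []} _ _ (s≤s (s≤s ()))

-- Cycles and forests in K₄

open Graph K₄ using (ends; Joins; _∼?_)

joins? : ∀ e u v → Dec (Joins e u v)
joins? e u v = ≡-dec _≟ᶠ_ _≟ᶠ_ (ends e) (u , v) ⊎-dec ≡-dec _≟ᶠ_ _≟ᶠ_ (ends e) (v , u)

K₄-triangle : ∀ e → ∃[ f ] ∃[ g ] ∃[ w ]
  (f ≢ e × Joins f (proj₁ (ends e)) w × g ≢ e × Joins g w (proj₂ (ends e)))
K₄-triangle 0F = 1F , 3F , 2F , (λ ()) , inj₁ ≡.refl , (λ ()) , inj₂ ≡.refl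
K₄-triangle 1F = 0F , 3F , 1F , (λ ()) , inj₁ ≡.refl , (λ ()) , inj₁ ≡.refl
K₄-triangle 2F = 0F , 4F , 1F , (λ ()) , inj₁ ≡.refl , (λ ()) , inj₁ ≡.refl
K₄-triangle 3F = 0F , 1F , 0F , (λ ()) , inj₂ ≡.refl , (λ ()) , inj₁ ≡.refl
K₄-triangle 4F = 0F , 2F , 0F , (λ ()) , inj₂ ≡.refl , (λ ()) , inj₁ ≡.refl
K₄-triangle 5F = 1F , 2F , 0F , (λ ()) , inj₂ ≡.refl , (λ ()) , inj₁ ≡.refl

-- On four vertices no other cycle lengths occur. The closing step is kept apart from the others in
-- spirit: `Acyclic` takes a path and forbids that step.
Cyclic₃ Cyclic₄ Cyclic : Subset 6 → Set
Cyclic₃ H = ∃[ a ] ∃[ b ] ∃[ c ]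
  (Step K₄ H a b × Step K₄ H b c × Step K₄ H c a × Unique (a ∷ b ∷ c ∷ []))
Cyclic₄ H = ∃[ a ] ∃[ b ] ∃[ c ] ∃[ d ]
  (Step K₄ H a b × Step K₄ H b c × Step K₄ H c d × Step K₄ H d a × Unique (a ∷ b ∷ c ∷ d ∷ []))
Cyclic H = Cyclic₃ H ⊎ Cyclic₄ H

Cyclic-⊆ : ∀ {H K} → H ⊆ K → Cyclic H → Cyclic K
Cyclic-⊆ {H} {K} H⊆K = Sum.map
  (λ (a , b , c , s , t , r , abc!) → a , b , c , step s , step t , step r , abc!)
  (λ (a , b , c , d , s , t , r , q , abcd!) →
    a , b , c , d , step s , step t , step r , step q , abcd!)
  where
  step : ∀ {u v} → Step K₄ H u v → Step K₄ K u v
  step (e , e∈H , j) = e , H⊆K e∈H , j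

-- The four triangles and the three quadrilaterals.
cycles : List (Subset 6)
cycles = map (λ es → ⋃ (map ⁅_⁆ es))
  ( (0F ∷ 1F ∷ 3F ∷ []) ∷ (0F ∷ 2F ∷ 4F ∷ []) ∷ (1F ∷ 2F ∷ 5F ∷ []) ∷ (3F ∷ 4F ∷ 5F ∷ [])
  ∷ (1F ∷ 2F ∷ 3F ∷ 4F ∷ []) ∷ (0F ∷ 2F ∷ 3F ∷ 5F ∷ []) ∷ (0F ∷ 1F ∷ 4F ∷ 5F ∷ []) ∷ [])

cycles-cyclic : All Cyclic cycles
cycles-cyclic =
    -- The vertices in cyclic order are followed by the indices of the edges in the same order; the
    -- side conditions are settled by evaluation.
    triangle 0F 1F 2F  0F 3F 1F
  ∷ triangle 0F 1F 3F  0F 4F 2F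
  ∷ triangle 0F 2F 3F  1F 5F 2F
  ∷ triangle 1F 2F 3F  3F 5F 4F
  ∷ quadrilateral 0F 2F 1F 3F  1F 3F 4F 2F
  ∷ quadrilateral 0F 1F 2F 3F  0F 3F 5F 2F
  ∷ quadrilateral 0F 2F 3F 1F  1F 5F 4F 0F
  ∷ []
  where
  step : ∀ {H u v} e → True (e ∈? H) → True (joins? e u v) → Step K₄ H u v
  step e e∈H j = e , toWitness e∈H , toWitness j

  triangle : ∀ {H} a b c d e f →
    {True (d ∈? H)} → {True (joins? d a b)} → {True (e ∈? H)} → {True (joins? e b c)} →
    {True (f ∈? H)} → {True (joins? f c a)} → {True (unique? _≟ᶠ_ (a ∷ b ∷ c ∷ []))} → Cyclic H
  triangle a b c d e f {d∈} {j} {e∈} {k} {f∈} {l} {abc!} =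
    inj₁ (a , b , c , step d d∈ j , step e e∈ k , step f f∈ l , toWitness abc!)

  quadrilateral : ∀ {H} a b c d e f g h →
    {True (e ∈? H)} → {True (joins? e a b)} → {True (f ∈? H)} → {True (joins? f b c)} →
    {True (g ∈? H)} → {True (joins? g c d)} → {True (h ∈? H)} → {True (joins? h d a)} →
    {True (unique? _≟ᶠ_ (a ∷ b ∷ c ∷ d ∷ []))} → Cyclic H
  quadrilateral a b c d e f g h {e∈} {j} {f∈} {k} {g∈} {l} {h∈} {n} {abcd!} =
    inj₂ (a , b , c , d , step e e∈ j , step f f∈ k , step g g∈ l , step h h∈ n , toWitness abcd!)

acyclic⇒¬cyclic : ∀ {H} → Acyclic K₄ H → ¬ Cyclic H
acyclic⇒¬cyclic acyclic (inj₁ (_ , _ , _ , s , t , r , abc!)) =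
  acyclic (s ◅ t ◅ ε , abc!) (s≤s (s≤s (s≤s z≤n))) r
acyclic⇒¬cyclic acyclic (inj₂ (_ , _ , _ , _ , s , t , r , q , abcd!)) =
  acyclic (s ◅ t ◅ r ◅ ε , abcd!) (s≤s (s≤s (s≤s z≤n))) q

-- An exhaustive search through the 64 edge sets shows that each one with at least four edges
-- contains one of the listed cycles.
K₄-acyclic⇒∣H∣≤3 : ∀ {H} → Acyclic K₄ H → ∣ H ∣ ℕ.≤ 3
K₄-acyclic⇒∣H∣≤3 {H} acyclic with ∣ H ∣ ℕ.≤? 3
... | yes ∣H∣≤3 = ∣H∣≤3
... | no  ∣H∣≰3 = contradiction (H , ∣H∣≰3 , no-cycle) large⇒cycle
  where
  no-cycle : ¬ Any (_⊆ H) cycles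
  no-cycle i with All.lookupAny cycles-cyclic i
  ... | cyclic , C⊆H = acyclic⇒¬cyclic acyclic (Cyclic-⊆ C⊆H cyclic)
  large⇒cycle : ¬ (∃[ H ] (¬ ∣ H ∣ ℕ.≤ 3 × ¬ Any (_⊆ H) cycles))
  large⇒cycle = toWitness
    {a? = ¬? (anySubset? λ H → ¬? (∣ H ∣ ℕ.≤? 3) ×-dec ¬? (Any.any? (_⊆? H) cycles))} _

K₄∉𝔉 : ¬ 𝔉 K₄
-- The collection of all fundamental cycles is trivially maximal, and its sum meets `T` in the whole
-- of `T`, which is a tree.
K₄∉𝔉 (_ , 𝒯 , dep) with dep (∁ T) (id , tree , λ _ J′⊆ _ _ → J′⊆)
  where
  open NormalSpanningTree 𝒯
  T⊆allCycles : T ⊆ allCycles 𝒯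
  T⊆allCycles {e} e∈T with K₄-triangle e
  ... | _ , _ , _ , f≢e , k , g≢e , l = triangle⇒∈allCycles 𝒯 e∈T (inj₁ ≡.refl) f≢e k g≢e l
  tree : MeetsInSubtree 𝒯 (∁ T)
  tree = ≡.subst (IsTree K₄)
    (⊆-antisym (λ e∈T → x∈p∩q⁺ (T⊆allCycles e∈T , e∈T)) (p∩q⊆q (allCycles 𝒯) T))
    ((λ u v _ _ → path u v) , acyclic)
... | ks , _ , ks⇔∁T , grow = contradiction
  (DEP⇒7≤m 𝒯 (λ e∈ks → x∈∁p⇒x∉p (Equivalence.to (ks⇔∁T _) e∈ks)) grow
    (ℕ.≤-trans 3≤∣∁T∣ (covered⇒∣p∣≤length ks (Equivalence.from (ks⇔∁T _)))))
  (λ { (s≤s (s≤s (s≤s (s≤s (s≤s (s≤s ())))))) })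
  where
  open NormalSpanningTree 𝒯
  3≤∣∁T∣ : 3 ℕ.≤ ∣ ∁ T ∣
  3≤∣∁T∣ = ℕ.≤-trans (ℕ.∸-monoʳ-≤ 6 (K₄-acyclic⇒∣H∣≤3 acyclic)) (ℕ.≤-reflexive (≡.sym (∣∁p∣≡n∸∣p∣ T)))

-- Real analysis

-- Integer coefficients are pairs (m , n) standing for m − n, kept reduced so
-- that equal coefficients are identical.
module IntegerRingSolver {c ℓ} (R : CommutativeRing c ℓ) where
  open CommutativeRing R
  open Mult semiring using () renaming (_×_ to _×ʳ_; ×-homo-+ to ×ʳ-homo-+; ×1-homo-* to ×ʳ1-homo-*)
  open RingProperties ring using
    (⁻¹-anti-homo‿-; -0#≈0#; -‿distribˡ-*; -‿distribʳ-*; -‿+-comm; -‿involutive)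
  open SetoidReasoning setoid

  reduce : ℕ → ℕ → ℕ × ℕ
  reduce (suc m) (suc n) = reduce m n
  reduce m       n       = m , n

  differences : RawRing 0ℓ 0ℓ
  differences = record
    { Carrier = ℕ × ℕ
    ; _≈_     = _≡_
    ; _+_     = λ (a , b) (c , d) → reduce (a ℕ.+ c) (b ℕ.+ d)
    ; _*_     = λ (a , b) (c , d) → reduce (a ℕ.* c ℕ.+ b ℕ.* d) (a ℕ.* d ℕ.+ b ℕ.* c)
    ; -_      = λ (a , b) → b , a
    ; 0#      = 0 , 0
    ; 1#      = 1 , 0
    }

  -- The first two clauses make the constants 0 and 1 of the solver denote
  -- 0# and 1# definitionally.
  value : ℕ × ℕ → Carrier
  value (0 , 0) = 0#
  value (1 , 0) = 1#
  value (a , b) = a ×ʳ 1# - b ×ʳ 1#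

  value-difference : ∀ a b → value (a , b) ≈ a ×ʳ 1# - b ×ʳ 1#
  value-difference 0             0       = sym (-‿inverseʳ 0#)
  value-difference 1             0       = sym (trans (+-cong (+-identityʳ 1#) -0#≈0#) (+-identityʳ 1#))
  value-difference 0             (suc b) = refl
  value-difference 1             (suc b) = refl
  value-difference (suc (suc a)) b       = refl

  interchange : ∀ a b c d → (a + b) + (c + d) ≈ (a + c) + (b + d)
  interchange a b c d = begin
    (a + b) + (c + d) ≈⟨ +-assoc a b (c + d) ⟩
    a + (b + (c + d)) ≈⟨ +-congˡ (+-assoc b c d) ⟨
    a + ((b + c) + d) ≈⟨ +-congˡ (+-congʳ (+-comm b c)) ⟩
    a + ((c + b) + d) ≈⟨ +-congˡ (+-assoc c b d) ⟩
    a + (c + (b + d)) ≈⟨ +-assoc a c (b + d) ⟨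
    (a + c) + (b + d) ∎

  difference-+ : ∀ a b c d → (a + c) - (b + d) ≈ (a - b) + (c - d)
  difference-+ a b c d = trans (+-congˡ (sym (-‿+-comm b d))) (interchange a c (- b) (- d))

  difference-* : ∀ a b c d → (a * c + b * d) - (a * d + b * c) ≈ (a - b) * (c - d)
  difference-* a b c d = sym (begin
    (a - b) * (c - d)                             ≈⟨ distribʳ (c - d) a (- b) ⟩
    a * (c - d) + - b * (c - d)                   ≈⟨ +-cong (distribˡ a c (- d)) (distribˡ (- b) c (- d)) ⟩
    (a * c + a * - d) + (- b * c + - b * - d)     ≈⟨ +-cong (+-congˡ (sym (-‿distribʳ-* a d)))
                                                      (+-cong (sym (-‿distribˡ-* b c)) -b*-d≈b*d) ⟩
    (a * c - a * d) + (- (b * c) + b * d)         ≈⟨ +-congˡ (+-comm _ _) ⟩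
    (a * c - a * d) + (b * d - b * c)             ≈⟨ difference-+ _ _ _ _ ⟨
    (a * c + b * d) - (a * d + b * c)             ∎)
    where
    -b*-d≈b*d : - b * - d ≈ b * d
    -b*-d≈b*d = trans (sym (-‿distribˡ-* b (- d)))
        (trans (-‿cong (sym (-‿distribʳ-* b d))) (-‿involutive _))

  value-reduce : ∀ a b → value (reduce a b) ≈ a ×ʳ 1# - b ×ʳ 1#
  value-reduce zero    b       = value-difference 0 b
  value-reduce (suc a) zero    = value-difference (suc a) 0
  value-reduce (suc a) (suc b) = begin
    value (reduce a b)                      ≈⟨ value-reduce a b ⟩
    a ×ʳ 1# - b ×ʳ 1#                       ≈⟨ +-identityˡ _ ⟨
    0# + (a ×ʳ 1# - b ×ʳ 1#)                ≈⟨ +-congʳ (-‿inverseʳ 1#) ⟨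
    (1# - 1#) + (a ×ʳ 1# - b ×ʳ 1#)         ≈⟨ difference-+ _ _ _ _ ⟨
    (1# + a ×ʳ 1#) - (1# + b ×ʳ 1#)         ∎

  morphism : differences -Raw-AlmostCommutative⟶ fromCommutativeRing R
  morphism = record
    { ⟦_⟧    = value
    ; +-homo = λ (a , b) (c , d) → trans (value-reduce (a ℕ.+ c) _) (trans
        (+-cong (×ʳ-homo-+ 1# a c) (-‿cong (×ʳ-homo-+ 1# b d)))
        (trans (difference-+ _ _ _ _) (sym (+-cong (value-difference a b) (value-difference c d)))))
    ; *-homo = λ (a , b) (c , d) → trans (value-reduce (a ℕ.* c ℕ.+ b ℕ.* d) _) (trans
        (+-cong (homo a c b d) (-‿cong (homo a d b c)))
        (trans (difference-* _ _ _ _) (sym (*-cong (value-difference a b) (value-difference c d)))))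
    ; -‿homo = λ (a , b) → trans (value-difference b a)
        (sym (trans (-‿cong (value-difference a b)) (⁻¹-anti-homo‿- _ _)))
    ; 0-homo = refl
    ; 1-homo = refl
    }
    where
    homo : ∀ a c b d → (a ℕ.* c ℕ.+ b ℕ.* d) ×ʳ 1# ≈
                       (a ×ʳ 1#) * (c ×ʳ 1#) + (b ×ʳ 1#) * (d ×ʳ 1#)
    homo a c b d = trans (×ʳ-homo-+ 1# (a ℕ.* c) (b ℕ.* d)) (+-cong (×ʳ1-homo-* a c) (×ʳ1-homo-* b d))

  _coeff≟_ : WeaklyDecidable (λ x y → value x ≈ value y)
  (a , b) coeff≟ (c , d) with a ℕ.+ d ℕ.≟ c ℕ.+ b
  ... | no _ = nothing
  ... | yes a+d≡c+b = just (begin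
    value (a , b)           ≈⟨ value-difference a b ⟩
    a′ - b′                 ≈⟨ +-identityʳ _ ⟨
    (a′ - b′) + 0#          ≈⟨ +-congˡ (-‿inverseʳ d′) ⟨
    (a′ - b′) + (d′ - d′)   ≈⟨ difference-+ a′ b′ d′ d′ ⟨
    (a′ + d′) - (b′ + d′)   ≈⟨ +-congʳ eq ⟩
    (c′ + b′) - (b′ + d′)   ≈⟨ +-congˡ (-‿cong (+-comm b′ d′)) ⟩
    (c′ + b′) - (d′ + b′)   ≈⟨ difference-+ c′ d′ b′ b′ ⟩
    (c′ - d′) + (b′ - b′)   ≈⟨ +-congˡ (-‿inverseʳ b′) ⟩
    (c′ - d′) + 0#          ≈⟨ +-identityʳ _ ⟩
    c′ - d′                 ≈⟨ value-difference c d ⟨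
    value (c , d)           ∎)
    where
    a′ = a ×ʳ 1#
    b′ = b ×ʳ 1#
    c′ = c ×ʳ 1#
    d′ = d ×ʳ 1#
    eq : a′ + d′ ≈ c′ + b′
    eq = trans (sym (×ʳ-homo-+ 1# a d)) (trans (reflexive (≡.cong (_×ʳ 1#) a+d≡c+b)) (×ʳ-homo-+ 1# c b))

  open RingSolver differences (fromCommutativeRing R) morphism _coeff≟_ public

  :0 :1 : ∀ {n} → Polynomial n
  :0 = con (0 , 0)
  :1 = con (1 , 0)

module RealAnalysis (𝓡 : RealNumbers) where
  open RealNumbers 𝓡
  open IntegerRingSolver commutativeRing using (solve; _:=_; _:+_; _:*_; _:-_; :-_; :0; :1)
  open SemiringDefs (Semiring.rawSemiring semiring) using (_^_)
  open Mult semiring using () renaming (_×_ to _×ʳ_; ×-homo-+ to ×ʳ-homo-+; ×1-homo-* to ×ʳ1-homo-*)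
  open IsTotalOrder isTotalOrder public using (total) renaming
    ( refl to ≤-refl; reflexive to ≤-reflexive; trans to ≤-trans; antisym to ≤-antisym
    ; ≤-respˡ-≈ to ≤-respˡ; ≤-respʳ-≈ to ≤-respʳ )
  open SetoidReasoning setoid

  ι : ℕ → ℝ
  ι n = n ×ʳ 1#

  0≤y-x : ∀ {x y} → x ≤ y → 0# ≤ y - x
  0≤y-x {x} {y} x≤y = ≤-respˡ (-‿inverseˡ x) (≤-respʳ (+-comm (- x) y) (+-monoʳ-≤ (- x) x≤y))

  -- Inequalities are proved by exhibiting y − x as a nonnegative expression.
  ≤-by : ∀ {x y s} → 0# ≤ s → s ≈ y - x → x ≤ y
  ≤-by {x} {y} {s} 0≤s s≈y-x = ≤-respˡ (+-identityʳ x) (≤-respʳ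
    (trans (+-congˡ s≈y-x) (solve 2 (λ x y → x :+ (y :- x) := y) refl x y)) (+-monoʳ-≤ x 0≤s))

  +-nonneg : ∀ {x y} → 0# ≤ x → 0# ≤ y → 0# ≤ x + y
  +-nonneg {x} {y} 0≤x 0≤y = ≤-trans 0≤x (≤-respˡ (+-identityʳ x) (+-monoʳ-≤ x 0≤y))

  0≤-x : ∀ {x} → x ≤ 0# → 0# ≤ - x
  0≤-x {x} x≤0 = ≤-respʳ (+-identityˡ (- x)) (0≤y-x x≤0)

  square-nonneg : ∀ x → 0# ≤ x * x
  square-nonneg x with total 0# x
  ... | inj₁ 0≤x = *-nonneg 0≤x 0≤x
  ... | inj₂ x≤0 = ≤-respʳ (solve 1 (λ x → (:- x) :* (:- x) := x :* x) refl x)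
                           (*-nonneg (0≤-x x≤0) (0≤-x x≤0))

  0≤1 : 0# ≤ 1#
  0≤1 = ≤-respʳ (*-identityˡ 1#) (square-nonneg 1#)

  1≰0 : ¬ 1# ≤ 0#
  1≰0 1≤0 = 0≉1 (≤-antisym 0≤1 1≤0)

  0≰-1 : ¬ 0# ≤ - 1#
  0≰-1 0≤-1 = 1≰0 (≤-by 0≤-1 (sym (+-identityˡ _)))

  +-mono-≤ : ∀ {x y u v} → x ≤ y → u ≤ v → x + u ≤ y + v
  +-mono-≤ {x} {y} {u} {v} x≤y u≤v = ≤-by (+-nonneg (0≤y-x x≤y) (0≤y-x u≤v))
    (solve 4 (λ x y u v → (y :- x) :+ (v :- u) := (y :+ v) :- (x :+ u)) refl x y u v)

  *-monoʳ-≤ : ∀ {z x y} → 0# ≤ z → x ≤ y → z * x ≤ z * y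
  *-monoʳ-≤ {z} {x} {y} 0≤z x≤y = ≤-by (*-nonneg 0≤z (0≤y-x x≤y))
    (solve 3 (λ x y z → z :* (y :- x) := z :* y :- z :* x) refl x y z)

  *-monoˡ-≤ : ∀ {z x y} → 0# ≤ z → x ≤ y → x * z ≤ y * z
  *-monoˡ-≤ {z} {x} {y} 0≤z x≤y = ≤-respˡ (*-comm z x) (≤-respʳ (*-comm z y) (*-monoʳ-≤ 0≤z x≤y))

  inverse-nonneg : ∀ {x y} → 0# ≤ x → x * y ≈ 1# → 0# ≤ y
  inverse-nonneg {x} {y} 0≤x xy≈1 with total 0# y
  ... | inj₁ 0≤y = 0≤y
  ... | inj₂ y≤0 = contradiction
    (≤-respʳ (trans (solve 2 (λ x y → x :* (:- y) := :- (x :* y)) refl x y) (-‿cong xy≈1))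
             (*-nonneg 0≤x (0≤-x y≤0)))
    0≰-1

  double-nonneg : ∀ {x} → 0# ≤ x + x → 0# ≤ x
  double-nonneg {x} 0≤2x with total 0# x
  ... | inj₁ 0≤x = 0≤x
  ... | inj₂ x≤0 = ≤-by (+-nonneg 0≤2x (0≤-x x≤0))
    (solve 1 (λ x → (x :+ x) :- x := x :- :0) refl x)

  ι-nonneg : ∀ n → 0# ≤ ι n
  ι-nonneg zero    = ≤-refl
  ι-nonneg (suc n) = +-nonneg 0≤1 (ι-nonneg n)

  ι-mono : ∀ {m n} → m ℕ.≤ n → ι m ≤ ι n
  ι-mono {n = n} z≤n = ι-nonneg n
  ι-mono (s≤s m≤n) = +-monoʳ-≤ 1# (ι-mono m≤n)

  ι-pos : ∀ {n} → 1 ℕ.≤ n → ¬ ι n ≈ 0#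
  ι-pos 1≤n ιn≈0 = 1≰0 (≤-trans (≤-reflexive (sym (+-identityʳ 1#))) (≤-respʳ ιn≈0 (ι-mono 1≤n)))

  ι-+ : ∀ m n → ι (m ℕ.+ n) ≈ ι m + ι n
  ι-+ = ×ʳ-homo-+ 1#

  ι-* : ∀ m n → ι (m ℕ.* n) ≈ ι m * ι n
  ι-* = ×ʳ1-homo-*

  ^-nonneg : ∀ {x} n → 0# ≤ x → 0# ≤ x ^ n
  ^-nonneg zero    0≤x = 0≤1
  ^-nonneg (suc n) 0≤x = *-nonneg 0≤x (^-nonneg n 0≤x)

  -- The supremum s of {0} ∪ {2 | P} satisfies s ≤ 1 or 1 ≤ s, and in the
  -- latter case some element of this set is positive.
  excluded-middle : (P : Set) → Dec P
  excluded-middle P with supremum (λ x → x ≈ 0# ⊎ (P × x ≈ 1# + 1#)) (0# , inj₁ refl)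
    (1# + 1# , λ { x (inj₁ x≈0) → ≤-respˡ (sym x≈0) (+-nonneg 0≤1 0≤1)
                 ; x (inj₂ (_ , x≈2)) → ≤-reflexive x≈2 })
  ... | s , upper , least with total s 1#
  ...   | inj₁ s≤1 = no λ p → 1≰0 (≤-by (0≤y-x (≤-trans (upper (1# + 1#) (inj₂ (p , refl))) s≤1))
          (solve 0 (:1 :- (:1 :+ :1) := :0 :- :1) refl))
  ...   | inj₂ 1≤s with least 0# (≤-trans 0≤1 1≤s , λ 0≈s → 1≰0 (≤-respʳ (sym 0≈s) 1≤s))
  ...     | x , inj₁ x≈0 , _ , 0≉x = contradiction (sym x≈0) 0≉x
  ...     | x , inj₂ (p , _) , _   = yes p

  ≮⇒≥ : ∀ {x y} → ¬ y <ʳ x → x ≤ y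
  ≮⇒≥ {x} {y} y≮x with total x y
  ... | inj₁ x≤y = x≤y
  ... | inj₂ y≤x with excluded-middle (y ≈ x)
  ...   | yes y≈x = ≤-reflexive (sym y≈x)
  ...   | no  y≉x = contradiction (y≤x , y≉x) y≮x

  -- If all naturals were below `x`, they would have a supremum s. Some natural exceeds s - 1, and
  -- its successor would then exceed s.
  archimedean : ∀ x → ∃[ n ] x ≤ ι n
  archimedean x with excluded-middle (∃[ n ] x ≤ ι n)
  ... | yes bound = bound
  ... | no  ¬bound with supremum (λ y → ∃[ n ] y ≈ ι n) (0# , 0 , refl)
    (x , λ { y (n , y≈ιn) → ≤-respˡ (sym y≈ιn)
               ([ id , (λ x≤ιn → contradiction (n , x≤ιn) ¬bound) ]′ (total (ι n) x)) })
  ...   | s , upper , least with least (s - 1#)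
    ( ≤-by 0≤1 (solve 1 (λ s → :1 := s :- (s :- :1)) refl s)
    , λ s-1≈s → 0≉1 (trans (trans (sym (-‿inverseʳ s)) (+-congˡ (-‿cong (sym s-1≈s))))
                       (solve 1 (λ s → s :- (s :- :1) := :1) refl s)) )
  ...     | y , (n , y≈ιn) , s-1≤y , s-1≉y = contradiction (≤-antisym s-1≤y y≤s-1) s-1≉y
    where
    y≤s-1 : y ≤ s - 1#
    y≤s-1 = ≤-by (0≤y-x (upper (ι (suc n)) (suc n , refl)))
      (trans (+-congˡ (-‿cong (+-congˡ (sym y≈ιn))))
        (solve 2 (λ s y → s :- (:1 :+ y) := (s :- :1) :- y) refl s y))

  -- Were `x` positive, a natural n ≥ K x⁻¹ would satisfy n + 1 ≤ K x⁻¹ ≤ n.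
  bounded-multiples : ∀ {x K} → (∀ n → ι (suc n) * x ≤ K) → x ≤ 0#
  bounded-multiples {x} {K} bound = ≮⇒≥ λ (0≤x , 0≉x) →
    let xi≈1  = *-inverseʳ x (0≉x ∘ sym)
        0≤i   = inverse-nonneg 0≤x xi≈1
        n , Ki≤ιn = archimedean (K * x ⁻¹)
    in 1≰0 (≤-by (0≤y-x (≤-trans (*-monoˡ-≤ 0≤i (bound n)) Ki≤ιn))
         (begin
           ι n - (1# + ι n) * x * x ⁻¹   ≈⟨ solve 3 (λ n x i → n :- (:1 :+ n) :* x :* i :=
               n :- (:1 :+ n) :* (x :* i)) refl (ι n) x (x ⁻¹) ⟩
           ι n - (1# + ι n) * (x * x ⁻¹) ≈⟨ +-congˡ (-‿cong (*-congˡ xi≈1)) ⟩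
           ι n - (1# + ι n) * 1#         ≈⟨ solve 1 (λ n → n :- (:1 :+ n) :* :1 := :0 :- :1)
               refl (ι n) ⟩
           0# - 1#                       ∎))

  -- The limit is the supremum of the lower ends. If it exceeded some `u k`, then so would some
  -- `l j`, but any lower end is below any upper end, as comparison at the index `j ⊔ k` shows.
  nested-intervals : (l u : ℕ → ℝ) → (∀ k → l k ≤ l (suc k)) → (∀ k → u (suc k) ≤ u k) →
    (∀ k → l k ≤ u k) → ∃[ L ] ∀ k → l k ≤ L × L ≤ u k
  nested-intervals l u l↑ u↓ l≤u =
    L , λ k → upper (l k) (k , refl) , ≮⇒≥ λ uk<L →
      let x , (j , x≈lj) , uk≤x , uk≉x = least (u k) uk<L
      in uk≉x (≤-antisym uk≤x (≤-respˡ (sym x≈lj) (l≤u′ j k)))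
    where
    l-mono : ∀ {j k} → j ℕ.≤′ k → l j ≤ l k
    l-mono ℕ.≤′-refl       = ≤-refl
    l-mono (ℕ.≤′-step j≤k) = ≤-trans (l-mono j≤k) (l↑ _)
    u-anti : ∀ {j k} → j ℕ.≤′ k → u k ≤ u j
    u-anti ℕ.≤′-refl       = ≤-refl
    u-anti (ℕ.≤′-step j≤k) = ≤-trans (u↓ _) (u-anti j≤k)
    l≤u′ : ∀ j k → l j ≤ u k
    l≤u′ j k = ≤-trans (l-mono (ℕ.≤⇒≤′ (ℕ.m≤m⊔n j k))) (≤-trans (l≤u (j ℕ.⊔ k)) (u-anti
        (ℕ.≤⇒≤′ (ℕ.m≤n⊔m j k))))
    sup = supremum (λ x → ∃[ k ] x ≈ l k) (l 0 , 0 , refl)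
            (u 0 , λ { x (k , x≈lk) → ≤-respˡ (sym x≈lk) (l≤u′ k 0) })
    L     = proj₁ sup
    upper = proj₁ (proj₂ sup)
    least = proj₂ (proj₂ sup)

  -- This is |x| ≤ r without an absolute value, in a form whose two halves can be added and
  -- multiplied as nonnegative numbers.
  Bounded : ℝ → ℝ → Set
  Bounded x r = 0# ≤ r + x × 0# ≤ r - x

  Bounded-cong : ∀ {x y r s} → x ≈ y → r ≈ s → Bounded x r → Bounded y s
  Bounded-cong x≈y r≈s (p , q) = ≤-respʳ (+-cong r≈s x≈y) p , ≤-respʳ (+-cong r≈s (-‿cong x≈y)) q

  Bounded-weaken : ∀ {x r s} → r ≤ s → Bounded x r → Bounded x s
  Bounded-weaken {x} {r} {s} r≤s (p , q) =
    ≤-respʳ (solve 3 (λ x r s → (s :- r) :+ (r :+ x) := s :+ x) refl x r s) (+-nonneg (0≤y-x r≤s) p) ,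
    ≤-respʳ (solve 3 (λ x r s → (s :- r) :+ (r :- x) := s :- x) refl x r s) (+-nonneg (0≤y-x r≤s) q)

  Bounded⇒0≤ : ∀ {x r} → Bounded x r → 0# ≤ r
  Bounded⇒0≤ {x} {r} (p , q) = double-nonneg (≤-respʳ
    (solve 2 (λ x r → (r :+ x) :+ (r :- x) := r :+ r) refl x r) (+-nonneg p q))

  Bounded-refl : ∀ {r} → 0# ≤ r → Bounded r r
  Bounded-refl {r} 0≤r = +-nonneg 0≤r 0≤r , ≤-reflexive (sym (-‿inverseʳ r))

  Bounded-0 : ∀ {r} → 0# ≤ r → Bounded 0# r
  Bounded-0 {r} 0≤r = ≤-respʳ (sym (+-identityʳ r)) 0≤r ,
    ≤-respʳ (solve 1 (λ r → r := r :- :0) refl r) 0≤r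

  Bounded-neg : ∀ {x r} → Bounded x r → Bounded (- x) r
  Bounded-neg {x} {r} (p , q) = q , ≤-respʳ (solve 2 (λ x r → r :+ x := r :- (:- x)) refl x r) p

  Bounded-+ : ∀ {x y r s} → Bounded x r → Bounded y s → Bounded (x + y) (r + s)
  Bounded-+ {x} {y} {r} {s} (p , q) (p′ , q′) =
    ≤-respʳ (solve 4 (λ x y r s → (r :+ x) :+ (s :+ y) := (r :+ s) :+ (x :+ y))
        refl x y r s) (+-nonneg p p′) ,
    ≤-respʳ (solve 4 (λ x y r s → (r :- x) :+ (s :- y) := (r :+ s) :- (x :+ y))
        refl x y r s) (+-nonneg q q′)

  -- The doubles of rs + xy and rs - xy are sums of two products of the given nonnegative numbers,
  -- for instance (r + x)(s + y) + (r - x)(s - y) for the first.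
  Bounded-* : ∀ {x y r s} → Bounded x r → Bounded y s → Bounded (x * y) (r * s)
  Bounded-* {x} {y} {r} {s} (p , q) (p′ , q′) =
    double-nonneg (≤-respʳ
      (solve 4 (λ x y r s → (r :+ x) :* (s :+ y) :+ (r :- x) :* (s :- y) :=
          (r :* s :+ x :* y) :+ (r :* s :+ x :* y)) refl x y r s)
      (+-nonneg (*-nonneg p p′) (*-nonneg q q′))) ,
    double-nonneg (≤-respʳ
      (solve 4 (λ x y r s → (r :+ x) :* (s :- y) :+ (r :- x) :* (s :+ y) :=
          (r :* s :- x :* y) :+ (r :* s :- x :* y)) refl x y r s)
      (+-nonneg (*-nonneg p q′) (*-nonneg q p′)))

  Bounded⇒square≤ : ∀ {x r} → Bounded x r → x * x ≤ r * r
  Bounded⇒square≤ {x} {r} (p , q) = ≤-by (*-nonneg p q)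
    (solve 2 (λ x r → (r :+ x) :* (r :- x) := r :* r :- x :* x) refl x r)

  abstract
    -- The common ratio of all error bounds. The value 1/4 serves two ends: q + q ≤ 1 makes the
    -- intervals in `geometric-limit` nest, and (k + 1)² ≤ 4^k absorbs the linear factor that the
    -- Cauchy product brings in.
    q : ℝ
    q = ι 4 ⁻¹

    4q≈1 : ι 4 * q ≈ 1#
    4q≈1 = *-inverseʳ (ι 4) (ι-pos {4} (s≤s z≤n))

  0≤q : 0# ≤ q
  0≤q = inverse-nonneg {ι 4} (ι-nonneg 4) 4q≈1

  0≤q^ : ∀ k → 0# ≤ q ^ k
  0≤q^ k = ^-nonneg k 0≤q

  ι4^*q^≈1 : ∀ k → ι (4 ℕ.^ k) * q ^ k ≈ 1#
  ι4^*q^≈1 zero    = trans (*-identityʳ _) (+-identityʳ 1#)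
  ι4^*q^≈1 (suc k) = begin
    ι (4 ℕ.* 4 ℕ.^ k) * (q * q ^ k)       ≈⟨ *-congʳ (ι-* 4 (4 ℕ.^ k)) ⟩
    (ι 4 * ι (4 ℕ.^ k)) * (q * q ^ k)     ≈⟨ solve 4 (λ a b c d → (a :* b) :* (c :* d) :=
        (a :* c) :* (b :* d)) refl (ι 4) (ι (4 ℕ.^ k)) q (q ^ k) ⟩
    (ι 4 * q) * (ι (4 ℕ.^ k) * q ^ k)     ≈⟨ *-cong 4q≈1 (ι4^*q^≈1 k) ⟩
    1# * 1#                               ≈⟨ *-identityʳ 1# ⟩
    1#                                    ∎

  ι*q^≤1 : ∀ {n} k → n ℕ.≤ 4 ℕ.^ k → ι n * q ^ k ≤ 1#
  ι*q^≤1 k n≤4^k = ≤-trans (*-monoˡ-≤ (0≤q^ k) (ι-mono n≤4^k)) (≤-reflexive (ι4^*q^≈1 k))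

  [1+k]²≤4^k : ∀ k → suc k ℕ.* suc k ℕ.≤ 4 ℕ.^ k
  [1+k]²≤4^k zero    = s≤s z≤n
  [1+k]²≤4^k (suc k) = ≤.begin
    suc (suc k) ℕ.* suc (suc k)       ≤.≤⟨ ℕ.*-mono-≤ 2+k≤ 2+k≤ ⟩
    (2 ℕ.* suc k) ℕ.* (2 ℕ.* suc k)   ≤.≡⟨ ℕ.[m*n]*[o*p]≡[m*o]*[n*p] 2 (suc k) 2 (suc k) ⟩
    4 ℕ.* (suc k ℕ.* suc k)           ≤.≤⟨ ℕ.*-monoʳ-≤ 4 ([1+k]²≤4^k k) ⟩
    4 ℕ.^ suc k                       ≤.∎
    where
    module ≤ = ℕ.≤-Reasoning
    2+k≤ : suc (suc k) ℕ.≤ 2 ℕ.* suc k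
    2+k≤ = s≤s (ℕ.≤-trans (ℕ.≤-reflexive (≡.cong suc (≡.sym
        (ℕ.+-identityʳ k)))) (ℕ.m≤n+m (suc (k ℕ.+ 0)) k))

  k≤4^k : ∀ k → k ℕ.≤ 4 ℕ.^ k
  k≤4^k k = ℕ.≤-trans (ℕ.≤-trans (ℕ.n≤1+n k) (ℕ.m≤m*n (suc k) (suc k))) ([1+k]²≤4^k k)

  -- Multiplying the bound by k + 1 gives (k + 1) x ≤ (k + 1)² K q^k ≤ K, so the multiples of `x`
  -- are bounded.
  linear*q^-bounded⇒≤0 : ∀ {x K} → 0# ≤ K → (∀ k → x ≤ ι (suc k) * K * q ^ k) → x ≤ 0#
  linear*q^-bounded⇒≤0 {x} {K} 0≤K bound = bounded-multiples λ k →
    ≤-trans (*-monoʳ-≤ (ι-nonneg (suc k)) (bound k)) (≤-by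
      (*-nonneg 0≤K (0≤y-x (ι*q^≤1 k ([1+k]²≤4^k k))))
      (trans (*-congˡ (+-congˡ (-‿cong (*-congʳ (ι-* (suc k) (suc k))))))
        (solve 3 (λ n K p → K :* (:1 :- (n :* n) :* p) := K :- n :* (n :* K :* p))
            refl (ι (suc k)) K (q ^ k))))

  0≤1-2q : 0# ≤ 1# - (q + q)
  0≤1-2q = ≤-respʳ
    -- Since 4 q = 1, the difference 1 - 2 q is q + q. The nested sum of ones is what `ι 4` unfolds
    -- to.
    (trans (solve 1 (λ q → q :+ q := (one :+ (one :+ (one :+ (one :+ :0)))) :* q :- (q :+ q)) refl q)
           (+-congʳ 4q≈1))
    (+-nonneg 0≤q 0≤q)
    where one = :1

  -- The intervals around `a k` with radius 2 c q^k are nested: from one to the next the radius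
  -- drops by 2 c q^k (1 - q), which is at least the step bound c q^k because q ≤ 1/2.
  geometric-limit : ∀ (a : ℕ → ℝ) c → (∀ k → Bounded (a (suc k) - a k) (c * q ^ k)) →
    ∃[ L ] ∀ k → Bounded (L - a k) ((c + c) * q ^ k)
  geometric-limit a c step = proj₁ limit , λ k → let l≤L , L≤u = proj₂ limit k in
    ≤-respʳ (solve 3 (λ a r L → L :- (a :- r) := r :+ (L :- a))
        refl (a k) (r k) (proj₁ limit)) (0≤y-x l≤L) ,
    ≤-respʳ (solve 3 (λ a r L → (a :+ r) :- L := r :- (L :- a))
        refl (a k) (r k) (proj₁ limit)) (0≤y-x L≤u)
    where
    r : ℕ → ℝ
    r k = (c + c) * q ^ k
    0≤r : ∀ k → 0# ≤ r k
    0≤r k = ≤-respʳ (sym (distribʳ (q ^ k) c c)) (+-nonneg (Bounded⇒0≤ (step k)) (Bounded⇒0≤ (step k)))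
    shrink : ∀ k → 0# ≤ r k - r (suc k) - c * q ^ k
    shrink k = ≤-respʳ
      (solve 3 (λ c q p → c :* p :* (:1 :- (q :+ q)) :=
                          (c :+ c) :* p :- (c :+ c) :* (q :* p) :- c :* p) refl c q (q ^ k))
      (*-nonneg (Bounded⇒0≤ (step k)) 0≤1-2q)
    limit = nested-intervals (λ k → a k - r k) (λ k → a k + r k)
      (λ k → ≤-by (+-nonneg (proj₁ (step k)) (shrink k))
        (solve 5 (λ a b r s t → (t :+ (b :- a)) :+ (r :- s :- t) := (b :- s) :- (a :- r)) refl
          (a k) (a (suc k)) (r k) (r (suc k)) (c * q ^ k)))
      (λ k → ≤-by (+-nonneg (proj₂ (step k)) (shrink k))
        (solve 5 (λ a b r s t → (t :- (b :- a)) :+ (r :- s :- t) := (a :+ r) :- (b :+ s)) refl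
          (a k) (a (suc k)) (r k) (r (suc k)) (c * q ^ k)))
      (λ k → ≤-by (+-nonneg (0≤r k) (0≤r k))
        (solve 2 (λ a r → r :+ r := (a :+ r) :- (a :- r)) refl (a k) (r k)))

-- The exponential function

module Convolution {c ℓ} (R : CommutativeRing c ℓ) where
  open CommutativeRing R
  open IntegerRingSolver R using (solve; _:=_; _:+_; _:*_; _:-_; :0; :1)
  open Mult semiring using () renaming (_×_ to _×ʳ_)
  open SetoidReasoning setoid

  κ : ℕ → Carrier
  κ n = n ×ʳ 1#

  Σ : (ℕ → Carrier) → ℕ → Carrier
  Σ f zero    = 0#
  Σ f (suc n) = Σ f n + f n

  -- The n-th coefficient of the Cauchy product, the sum of e i * f (n - i). The recursion shifts
  -- `e` instead of subtracting indices.
  conv : (e f : ℕ → Carrier) → ℕ → Carrier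
  conv e f zero    = e 0 * f 0
  conv e f (suc n) = e 0 * f (suc n) + conv (e ∘ suc) f n

  conv-congˡ : ∀ {e e′} f n → (∀ k → e k ≈ e′ k) → conv e f n ≈ conv e′ f n
  conv-congˡ f zero    e≈ = *-congʳ (e≈ 0)
  conv-congˡ f (suc n) e≈ = +-cong (*-congʳ (e≈ 0)) (conv-congˡ f n (e≈ ∘ suc))

  conv-congʳ : ∀ e {f f′} n → (∀ k → f k ≈ f′ k) → conv e f n ≈ conv e f′ n
  conv-congʳ e zero    f≈ = *-congˡ (f≈ 0)
  conv-congʳ e (suc n) f≈ = +-cong (*-congˡ (f≈ (suc n))) (conv-congʳ (e ∘ suc) n f≈)

  conv-+ˡ : ∀ e e′ f n → conv (λ k → e k + e′ k) f n ≈ conv e f n + conv e′ f n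
  conv-+ˡ e e′ f zero    = distribʳ (f 0) (e 0) (e′ 0)
  conv-+ˡ e e′ f (suc n) = trans (+-congˡ (conv-+ˡ (e ∘ suc) (e′ ∘ suc) f n))
    (solve 5 (λ a a′ b u v → (a :+ a′) :* b :+ (u :+ v) := (a :* b :+ u) :+ (a′ :* b :+ v)) refl
      (e 0) (e′ 0) (f (suc n)) _ _)

  conv-*ˡ : ∀ z e f n → conv (λ k → z * e k) f n ≈ z * conv e f n
  conv-*ˡ z e f zero    = *-assoc z (e 0) (f 0)
  conv-*ˡ z e f (suc n) = trans (+-congˡ (conv-*ˡ z (e ∘ suc) f n))
    (solve 4 (λ z a b u → z :* a :* b :+ z :* u := z :* (a :* b :+ u)) refl z (e 0) (f (suc n)) _)

  conv-*ʳ : ∀ w e f n → conv e (λ k → w * f k) n ≈ w * conv e f n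
  conv-*ʳ w e f zero    = solve 3 (λ w a b → a :* (w :* b) := w :* (a :* b)) refl w (e 0) (f 0)
  conv-*ʳ w e f (suc n) = trans (+-congˡ (conv-*ʳ w (e ∘ suc) f n))
    (solve 4 (λ w a b u → a :* (w :* b) :+ w :* u := w :* (a :* b :+ u)) refl w (e 0) (f (suc n)) _)

  conv-shiftʳ : ∀ e f n → conv e f (suc n) ≈ conv e (f ∘ suc) n + e (suc n) * f 0
  conv-shiftʳ e f zero    = refl
  conv-shiftʳ e f (suc n) = trans (+-congˡ (conv-shiftʳ (e ∘ suc) f n)) (sym (+-assoc _ _ _))

  weigh : (ℕ → Carrier) → ℕ → Carrier
  weigh f k = κ k * f k

  -- The Leibniz rule for the derivation k ↦ k · e k.
  conv-weigh : ∀ e f n → conv (weigh e) f n + conv e (weigh f) n ≈ κ n * conv e f n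
  conv-weigh e f zero    =
    solve 2 (λ a b → (:0 :* a) :* b :+ a :* (:0 :* b) := :0 :* (a :* b)) refl (e 0) (f 0)
  conv-weigh e f (suc n) = begin
    ((0# * e 0) * f (suc n) + conv (weigh e ∘ suc) f n) + (e 0 * (κ (suc n) * f (suc n)) + v)
      ≈⟨ +-congʳ (+-congˡ (trans (conv-congˡ f n (λ k → distribʳ (e (suc k)) 1# (κ k)))
           (trans (conv-+ˡ (λ k → 1# * e (suc k)) (weigh (e ∘ suc)) f n)
               (+-congʳ (conv-*ˡ 1# (e ∘ suc) f n))))) ⟩
    ((0# * e 0) * f (suc n) + (1# * w + u)) + (e 0 * (κ (suc n) * f (suc n)) + v)
      ≈⟨ solve 6 (λ a b u v w k → ((:0 :* a) :* b :+ (:1 :* w :+ u)) :+ (a :* (k :* b) :+ v) :=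
                                  (u :+ v) :+ (w :+ a :* (k :* b)))
                                      refl (e 0) (f (suc n)) u v w (κ (suc n)) ⟩
    (u + v) + (w + e 0 * (κ (suc n) * f (suc n)))
      ≈⟨ +-congʳ (conv-weigh (e ∘ suc) f n) ⟩
    κ n * w + (w + e 0 * (κ (suc n) * f (suc n)))
      ≈⟨ solve 4 (λ a b w k → k :* w :+ (w :+ a :* ((:1 :+ k) :* b)) := (:1 :+ k) :* (a :* b :+ w))
          refl (e 0) (f (suc n)) w (κ n) ⟩
    κ (suc n) * (e 0 * f (suc n) + w) ∎
    where
    w = conv (e ∘ suc) f n
    u = conv (weigh (e ∘ suc)) f n
    v = conv (e ∘ suc) (weigh f) n

  -- The hypotheses say that the generating functions of `e` and `f` solve Y′ = z Y and Y′ = w Y. By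
  -- the Leibniz rule their product solves Y′ = (z + w) Y, which takes the place of the binomial
  -- theorem.
  conv-exponential : ∀ {z w e f} → (∀ k → κ (suc k) * e (suc k) ≈ z * e k) →
    (∀ k → κ (suc k) * f (suc k) ≈ w * f k) →
    ∀ n → κ (suc n) * conv e f (suc n) ≈ (z + w) * conv e f n
  conv-exponential {z} {w} {e} {f} ez fw n = begin
    κ (suc n) * conv e f (suc n)
      ≈⟨ conv-weigh e f (suc n) ⟨
    conv (weigh e) f (suc n) + conv e (weigh f) (suc n)
      ≈⟨ +-cong
           (+-congˡ (trans (conv-congˡ f n ez) (conv-*ˡ z e f n)))
           (trans (conv-shiftʳ e (weigh f) n) (+-congʳ (trans (conv-congʳ e n fw) (conv-*ʳ w e f n)))) ⟩
    ((0# * e 0) * f (suc n) + z * conv e f n) + (w * conv e f n + e (suc n) * (0# * f 0))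
      ≈⟨ solve 7 (λ a b c d z w u → ((:0 :* a) :* b :+ z :* u) :+ (w :* u :+ c :* (:0 :* d)) :=
          (z :+ w) :* u)
           refl (e 0) (f (suc n)) (e (suc n)) (f 0) z w (conv e f n) ⟩
    (z + w) * conv e f n ∎

  Σ-shift : ∀ e n → Σ e (suc n) ≈ e 0 + Σ (e ∘ suc) n
  Σ-shift e zero    = +-comm 0# (e 0)
  Σ-shift e (suc n) = trans (+-congʳ (Σ-shift e n)) (+-assoc _ _ _)

  Σ-conv-shift : ∀ e f n → Σ (conv e f) (suc n) ≈ e 0 * Σ f (suc n) + Σ (conv (e ∘ suc) f) n
  Σ-conv-shift e f zero    = solve 2 (λ a b → :0 :+ a :* b := a :* (:0 :+ b) :+ :0) refl (e 0) (f 0)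
  Σ-conv-shift e f (suc n) = trans (+-congʳ (Σ-conv-shift e f n))
    (solve 5 (λ a s b u v → (a :* s :+ u) :+ (a :* b :+ v) := a :* (s :+ b) :+ (u :+ v)) refl
      (e 0) (Σ f (suc n)) (f (suc n)) _ _)

  -- With n terms of `e`, unrolling turns the difference into the sum of e i * (F - Σ f (n - i))
  -- over i < n, where each coefficient of `e` meets a tail of the series of `f`.
  cauchy-remainder : ∀ e f F n → Σ e (suc n) * F - Σ (conv e f) (suc n) ≈
    e 0 * (F - Σ f (suc n)) + (Σ (e ∘ suc) n * F - Σ (conv (e ∘ suc) f) n)
  cauchy-remainder e f F n =
    trans (+-cong (*-congʳ (Σ-shift e n)) (-‿cong (Σ-conv-shift e f n)))
      (solve 5 (λ a s t u F → (a :+ s) :* F :- (a :* t :+ u) := a :* (F :- t) :+ (s :* F :- u)) refl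
        (e 0) _ (Σ f (suc n)) _ F)

-- Up to k = L the power is at most `L ^ L`. From there on, each step multiplies the left side by L
-- and the right side by k + 1 > L.
power≤factorial : ∀ L k → L ℕ.^ k ℕ.≤ L ℕ.^ L ℕ.* k !
power≤factorial zero    zero    = s≤s z≤n
power≤factorial zero    (suc k) = z≤n
power≤factorial (suc L) zero    = ℕ.≤-trans (ℕ.m^n>0 (suc L) (suc L)) (ℕ.m≤m*n _ 1)
power≤factorial L@(suc _) (suc k) with suc k ℕ.≤? L
... | yes 1+k≤L = ℕ.≤-trans (ℕ.^-monoʳ-≤ L 1+k≤L) (ℕ.m≤m*n _ (suc k !) {{suc k ℕ.!≢0}})
... | no  1+k≰L = ℕ.≤-trans (ℕ.*-mono-≤ (ℕ.<⇒≤ (ℕ.≰⇒> 1+k≰L)) (power≤factorial L k))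
  (ℕ.≤-reflexive (≡.trans (≡.sym (ℕ.*-assoc (suc k) (L ℕ.^ L) (k !)))
    (≡.trans (≡.cong (ℕ._* k !) (ℕ.*-comm (suc k) (L ℕ.^ L))) (ℕ.*-assoc (L ℕ.^ L) (suc k) (k !)))))

^-distribʳ-* : ∀ m n k → (m ℕ.* n) ℕ.^ k ≡ m ℕ.^ k ℕ.* n ℕ.^ k
^-distribʳ-* m n zero    = ≡.refl
^-distribʳ-* m n (suc k) = ≡.trans (≡.cong (m ℕ.* n ℕ.*_) (^-distribʳ-* m n k))
  (ℕ.[m*n]*[o*p]≡[m*o]*[n*p] m n (m ℕ.^ k) (n ℕ.^ k))

-- Complex numbers and bounds on their coordinates

module ComplexNumbers (𝓡 : RealNumbers) where
  open RealNumbers 𝓡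
  open RealAnalysis 𝓡
  open Complex 𝓡
  open IntegerRingSolver commutativeRing using (solve; _:=_; _:+_; _:*_; _:-_; :-_; :0; :1)
  open SemiringDefs (Semiring.rawSemiring semiring) using (_^_)

  -ᶜ_ conj : ℂ → ℂ
  -ᶜ z   = (- Re z) +i (- Im z)
  conj z = Re z +i (- Im z)

  ℂ-commutativeRing : CommutativeRing 0ℓ 0ℓ
  ℂ-commutativeRing = record
    { Carrier = ℂ ; _≈_ = _≈ᶜ_ ; _+_ = _+ᶜ_ ; _*_ = _*ᶜ_ ; -_ = -ᶜ_ ; 0# = 0ᶜ ; 1# = 1ᶜ
    ; isCommutativeRing = record
      { isRing = record
        { +-isAbelianGroup = record
          { isGroup = record
            { isMonoid = record
              { isSemigroup = record
                { isMagma = record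
                  { isEquivalence = record
                    { refl  = refl , refl
                    ; sym   = λ (p , q) → sym p , sym q
                    ; trans = λ (p , q) (p′ , q′) → trans p p′ , trans q q′
                    }
                  ; ∙-cong = λ (p , q) (p′ , q′) → +-cong p p′ , +-cong q q′
                  }
                ; assoc = λ u v w → +-assoc _ _ _ , +-assoc _ _ _
                }
              ; identity = (λ z → +-identityˡ _ , +-identityˡ _) , (λ z → +-identityʳ _ , +-identityʳ _)
              }
            ; inverse = (λ z → -‿inverseˡ _ , -‿inverseˡ _) , (λ z → -‿inverseʳ _ , -‿inverseʳ _)
            ; ⁻¹-cong = λ (p , q) → -‿cong p , -‿cong q
            }
          ; comm = λ u v → +-comm _ _ , +-comm _ _
          }
        ; *-cong = λ (p , q) (p′ , q′) →
            +-cong (*-cong p p′) (-‿cong (*-cong q q′)) , +-cong (*-cong p q′) (*-cong q p′)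
        ; *-assoc = λ (a +i b) (c +i d) (e +i f) →
            solve 6 (λ a b c d e f → (a :* c :- b :* d) :* e :- (a :* d :+ b :* c) :* f :=
                                     a :* (c :* e :- d :* f) :- b :* (c :* f :+ d :* e))
                                         refl a b c d e f ,
            solve 6 (λ a b c d e f → (a :* c :- b :* d) :* f :+ (a :* d :+ b :* c) :* e :=
                                     a :* (c :* f :+ d :* e) :+ b :* (c :* e :- d :* f))
                                         refl a b c d e f
        ; *-identity = 1ᶜ-identityˡ , λ z → let p , q = 1ᶜ-identityˡ z in
            trans (*ᶜ-comm-Re z 1ᶜ) p , trans (*ᶜ-comm-Im z 1ᶜ) q
        ; distrib =
            (λ (a +i b) (c +i d) (e +i f) →
              solve 6 (λ a b c d e f → a :* (c :+ e) :- b :* (d :+ f) :=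
                                       (a :* c :- b :* d) :+ (a :* e :- b :* f)) refl a b c d e f ,
              solve 6 (λ a b c d e f → a :* (d :+ f) :+ b :* (c :+ e) :=
                                       (a :* d :+ b :* c) :+ (a :* f :+ b :* e)) refl a b c d e f) ,
            (λ (a +i b) (c +i d) (e +i f) →
              solve 6 (λ a b c d e f → (c :+ e) :* a :- (d :+ f) :* b :=
                                       (c :* a :- d :* b) :+ (e :* a :- f :* b)) refl a b c d e f ,
              solve 6 (λ a b c d e f → (c :+ e) :* b :+ (d :+ f) :* a :=
                                       (c :* b :+ d :* a) :+ (e :* b :+ f :* a)) refl a b c d e f)
        }
      ; *-comm = λ z w → *ᶜ-comm-Re z w , *ᶜ-comm-Im z w
      }
    }
    where
    *ᶜ-comm-Re : ∀ z w → Re (z *ᶜ w) ≈ Re (w *ᶜ z)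
    *ᶜ-comm-Re (a +i b) (c +i d) =
      solve 4 (λ a b c d → a :* c :- b :* d := c :* a :- d :* b) refl a b c d
    *ᶜ-comm-Im : ∀ z w → Im (z *ᶜ w) ≈ Im (w *ᶜ z)
    *ᶜ-comm-Im (a +i b) (c +i d) =
      solve 4 (λ a b c d → a :* d :+ b :* c := c :* b :+ d :* a) refl a b c d
    1ᶜ-identityˡ : ∀ z → 1ᶜ *ᶜ z ≈ᶜ z
    1ᶜ-identityˡ (a +i b) =
      solve 2 (λ a b → :1 :* a :- :0 :* b := a) refl a b ,
      solve 2 (λ a b → :1 :* b :+ :0 :* a := b) refl a b

  module ℂ-ring = CommutativeRing ℂ-commutativeRing

  conj-cong : ∀ {z w} → z ≈ᶜ w → conj z ≈ᶜ conj w
  conj-cong (p , q) = p , -‿cong q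

  conj-+ : ∀ z w → conj (z +ᶜ w) ≈ᶜ conj z +ᶜ conj w
  conj-+ (a +i b) (c +i d) = refl , solve 2 (λ b d → :- (b :+ d) := :- b :+ :- d) refl b d

  conj-* : ∀ z w → conj (z *ᶜ w) ≈ᶜ conj z *ᶜ conj w
  conj-* (a +i b) (c +i d) =
    solve 4 (λ a b c d → a :* c :- b :* d := a :* c :- :- b :* :- d) refl a b c d ,
    solve 4 (λ a b c d → :- (a :* d :+ b :* c) := a :* :- d :+ :- b :* c) refl a b c d

  conj-involutive : ∀ z → conj (conj z) ≈ᶜ z
  conj-involutive (a +i b) = refl , solve 1 (λ b → :- :- b := b) refl b

  z*conj-z : ∀ z → z *ᶜ conj z ≈ᶜ ∣ z ∣² +i 0#
  z*conj-z (a +i b) =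
    solve 2 (λ a b → a :* a :- b :* :- b := a :* a :+ b :* b) refl a b ,
    solve 2 (λ a b → a :* :- b :+ b :* a := :0) refl a b

  𝕋⇒z*conj-z≈1 : ∀ {z} → 𝕋 z → z *ᶜ conj z ≈ᶜ 1ᶜ
  𝕋⇒z*conj-z≈1 {z} ∣z∣²≈1 = ℂ-ring.trans (z*conj-z z) (∣z∣²≈1 , refl)

  z*conj-z≈1⇒𝕋 : ∀ {z} → z *ᶜ conj z ≈ᶜ 1ᶜ → 𝕋 z
  z*conj-z≈1⇒𝕋 {z} (p , _) = trans (sym (proj₁ (z*conj-z z))) p

  -- Bounding the coordinates instead of the modulus avoids square roots, at the price of a factor 2
  -- in `Boundedᶜ-*`.
  Boundedᶜ : ℂ → ℝ → Set
  Boundedᶜ z r = Bounded (Re z) r × Bounded (Im z) r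

  Boundedᶜ-cong : ∀ {z w r s} → z ≈ᶜ w → r ≈ s → Boundedᶜ z r → Boundedᶜ w s
  Boundedᶜ-cong (p , q) r≈s (b , c) = Bounded-cong p r≈s b , Bounded-cong q r≈s c

  Boundedᶜ-weaken : ∀ {z r s} → r ≤ s → Boundedᶜ z r → Boundedᶜ z s
  Boundedᶜ-weaken r≤s (b , c) = Bounded-weaken r≤s b , Bounded-weaken r≤s c

  Boundedᶜ-conj : ∀ {z r} → Boundedᶜ z r → Boundedᶜ (conj z) r
  Boundedᶜ-conj (b , c) = b , Bounded-neg c

  Boundedᶜ-+ : ∀ {z w r s} → Boundedᶜ z r → Boundedᶜ w s → Boundedᶜ (z +ᶜ w) (r + s)
  Boundedᶜ-+ (b , c) (b′ , c′) = Bounded-+ b b′ , Bounded-+ c c′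

  Boundedᶜ-* : ∀ {z w r s} → Boundedᶜ z r → Boundedᶜ w s → Boundedᶜ (z *ᶜ w) (r * s + r * s)
  Boundedᶜ-* (b , c) (b′ , c′) =
    Bounded-+ (Bounded-* b b′) (Bounded-neg (Bounded-* c c′)) , Bounded-+ (Bounded-* b c′)
        (Bounded-* c b′)

  open Convolution ℂ-commutativeRing

  -- The remainder has n terms, the i-th being at most 2 (a q^i)(b q^(n-i)) = 2 a b q^n in each
  -- coordinate. In the induction the shift of `e` turns the constant `a` into `a * q`.
  cauchy-remainder-bound : ∀ {e f F a b} → (∀ k → Boundedᶜ (e k) (a * q ^ k)) →
    (∀ m → Boundedᶜ (F -ᶜ Σ f m) (b * q ^ m)) →
    ∀ n → Boundedᶜ (Σ e n *ᶜ F -ᶜ Σ (conv e f) n) (ι n * (a * b + a * b) * q ^ n)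
  cauchy-remainder-bound {F = F} eb fb zero =
    Boundedᶜ-cong
    (solve 2 (λ c d → :0 := (:0 :* c :- :0 :* d) :- :0) refl (Re F) (Im F) ,
     solve 2 (λ c d → :0 := (:0 :* d :+ :0 :* c) :- :0) refl (Re F) (Im F))
    (sym (trans (*-congʳ (zeroˡ _)) (zeroˡ _))) (Bounded-0 ≤-refl , Bounded-0 ≤-refl)
  cauchy-remainder-bound {e} {f} {F} {a} {b} eb fb (suc n) = Boundedᶜ-cong
    (ℂ-ring.sym (cauchy-remainder e f F n))
    (solve 5 (λ a b p q n →
        ((a :* :1) :* (b :* (q :* p)) :+ (a :* :1) :* (b :* (q :* p))) :+
        n :* ((a :* q) :* b :+ (a :* q) :* b) :* p :=
                            (:1 :+ n) :* (a :* b :+ a :* b) :* (q :* p)) refl a b (q ^ n) q (ι n))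
    (Boundedᶜ-+ (Boundedᶜ-* (eb 0) (fb (suc n)))
      (cauchy-remainder-bound {a = a * q} (λ k → Boundedᶜ-cong
          ℂ-ring.refl (sym (*-assoc a q (q ^ k))) (eb (suc k))) fb n))

  κ≈ι : ∀ n → κ n ≈ᶜ ι n +i 0#
  κ≈ι zero    = refl , refl
  κ≈ι (suc n) = +-congˡ (proj₁ (κ≈ι n)) , trans (+-congˡ (proj₂ (κ≈ι n))) (+-identityʳ 0#)

  κ-cancel : ∀ n {z} → κ (suc n) *ᶜ z ≈ᶜ 0ᶜ → z ≈ᶜ 0ᶜ
  κ-cancel n {a +i b} κz≈0 =
    cancel (trans (solve 3 (λ n a b → n :* a := n :* a :- :0 :* b) refl (ι (suc n)) a b) (proj₁ ιz≈0)) ,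
    cancel (trans (solve 3 (λ n a b → n :* b := n :* b :+ :0 :* a) refl (ι (suc n)) a b) (proj₂ ιz≈0))
    where
    ιz≈0 : (ι (suc n) +i 0#) *ᶜ (a +i b) ≈ᶜ 0ᶜ
    ιz≈0 = ℂ-ring.trans (ℂ-ring.*-congʳ (ℂ-ring.sym (κ≈ι (suc n)))) κz≈0
    i = ι (suc n) ⁻¹
    cancel : ∀ {x} → ι (suc n) * x ≈ 0# → x ≈ 0#
    cancel {x} nx≈0 = begin
      x                   ≈⟨ *-identityˡ x ⟨
      1# * x              ≈⟨ *-congʳ (*-inverseʳ (ι (suc n)) (ι-pos {suc n} (s≤s z≤n))) ⟨
      (ι (suc n) * i) * x ≈⟨ solve 3 (λ n i x → (n :* i) :* x := i :* (n :* x)) refl (ι (suc n)) i x ⟩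
      i * (ι (suc n) * x) ≈⟨ *-congˡ nx≈0 ⟩
      i * 0#              ≈⟨ zeroʳ i ⟩
      0#                  ∎
      where open SetoidReasoning setoid

-- Existence and modulus of e^{iθ}

module Exponential (𝓡 : RealNumbers) (θ : RealNumbers.ℝ 𝓡) where
  open RealNumbers 𝓡
  open RealAnalysis 𝓡
  open Complex 𝓡
  open ComplexNumbers 𝓡
  open Convolution ℂ-commutativeRing
  open IntegerRingSolver commutativeRing using (solve; _:=_; _:+_; _:*_; _:-_; :-_; :0; :1)
  open IntegerRingSolver ℂ-commutativeRing using ()
    renaming (solve to solveᶜ; _:=_ to _⊜_; _:+_ to _⊕_; _:*_ to _⊗_; _:-_ to _⊝_; :0 to :0ᶜ; :1 to :1ᶜ)
  open SemiringDefs (Semiring.rawSemiring semiring) using (_^_)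
  open SemiringDefs ℂ-rawSemiring using () renaming (_^_ to _^ᶜ_)

  z : ℂ
  z = 0# +i θ

  1/_! : ℕ → ℝ
  1/ k ! = ι (k !) ⁻¹

  k!*1/k!≈1 : ∀ k → ι (k !) * 1/ k ! ≈ 1#
  k!*1/k!≈1 k = *-inverseʳ (ι (k !)) (ι-pos (ℕ.1≤n! k))

  e : ℕ → ℂ
  e k = (1/ k ! +i 0#) *ᶜ z ^ᶜ k

  expSum≡Σ : ∀ n → expSum z n ≡ Σ e n
  expSum≡Σ zero    = ≡.refl
  expSum≡Σ (suc n) = ≡.cong (_+ᶜ e n) (expSum≡Σ n)

  e-suc : ∀ k → κ (suc k) *ᶜ e (suc k) ≈ᶜ z *ᶜ e k
  e-suc k = ℂ-ring.trans (ℂ-ring.*-congʳ (κ≈ι (suc k))) (ℂ-ring.trans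
    (solveᶜ 4 (λ n c z w → n ⊗ (c ⊗ (z ⊗ w)) ⊜ z ⊗ ((n ⊗ c) ⊗ w)) ℂ-ring.refl
      (ι (suc k) +i 0#) (1/ suc k ! +i 0#) z (z ^ᶜ k))
    (ℂ-ring.*-congˡ (ℂ-ring.*-congʳ
      ( trans (solve 2 (λ n c → n :* c :- :0 :* :0 := n :* c) refl (ι (suc k)) (1/ suc k !)) coefficient
      , solve 2 (λ n c → n :* :0 :+ :0 :* c := :0) refl (ι (suc k)) (1/ suc k !)))))
    where
    open SetoidReasoning setoid
    coefficient : ι (suc k) * 1/ suc k ! ≈ 1/ k !
    coefficient = begin
      ι (suc k) * 1/ suc k !                             ≈⟨ *-identityˡ _ ⟨
      1# * (ι (suc k) * 1/ suc k !)                      ≈⟨ *-congʳ (k!*1/k!≈1 k) ⟨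
      (ι (k !) * 1/ k !) * (ι (suc k) * 1/ suc k !)
        ≈⟨ solve 4 (λ f c n d → (f :* c) :* (n :* d) := ((n :* f) :* d) :* c)
            refl (ι (k !)) (1/ k !) (ι (suc k)) (1/ suc k !) ⟩
      ((ι (suc k) * ι (k !)) * 1/ suc k !) * 1/ k !      ≈⟨ *-congʳ (*-congʳ (ι-* (suc k) (k !))) ⟨
      (ι (suc k !) * 1/ suc k !) * 1/ k !                ≈⟨ *-congʳ (k!*1/k!≈1 (suc k)) ⟩
      1# * 1/ k !                                        ≈⟨ *-identityˡ _ ⟩
      1/ k !                                             ∎

  -- `m` bounds |θ|. `M` is its double because each multiplication by `z` doubles the bound in
  -- `Boundedᶜ-*`.
  m M : ℕ
  m = proj₁ (archimedean θ) ℕ.⊔ proj₁ (archimedean (- θ))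
  M = m ℕ.+ m

  θ-bounded : Bounded θ (ι m)
  θ-bounded =
    ≤-respʳ (solve 2 (λ r x → r :- (:- x) := r :+ x) refl (ι m) θ)
      (0≤y-x (≤-trans (proj₂ (archimedean (- θ))) (ι-mono (ℕ.m≤n⊔m (proj₁ (archimedean θ)) _)))) ,
    0≤y-x (≤-trans (proj₂ (archimedean θ)) (ι-mono (ℕ.m≤m⊔n (proj₁ (archimedean θ)) _)))

  z^-bounded : ∀ k → Boundedᶜ (z ^ᶜ k) (ι (M ℕ.^ k))
  z^-bounded zero    = Bounded-cong refl (sym (+-identityʳ 1#))
      (Bounded-refl 0≤1) , Bounded-0 (ι-nonneg 1)
  z^-bounded (suc k) = Boundedᶜ-cong ℂ-ring.refl
    (trans (sym (distribʳ _ (ι m) (ι m))) (trans (*-congʳ (sym (ι-+ m m))) (sym (ι-* M (M ℕ.^ k)))))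
    (Boundedᶜ-* (Bounded-0 (ι-nonneg m) , θ-bounded) (z^-bounded k))

  L : ℕ
  L = M ℕ.* 4

  -- `L ^ L` is the constant of `power≤factorial`; it is doubled for the product of 1/k! and z^k.
  a : ℝ
  a = ι (L ℕ.^ L) + ι (L ℕ.^ L)

  -- M ^ k / k ! = L ^ k / k ! * q ^ k with L = 4 M, and L ^ k / k ! ≤ L ^ L.
  e-bounded : ∀ k → Boundedᶜ (e k) (a * q ^ k)
  e-bounded k = Boundedᶜ-weaken (≤-respʳ (sym (distribʳ (q ^ k) (ι (L ℕ.^ L)) (ι (L ℕ.^ L))))
      (+-mono-≤ bound bound))
    (Boundedᶜ-* (Bounded-refl 0≤1/k! , Bounded-0 0≤1/k!) (z^-bounded k))
    where
    open SetoidReasoning setoid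
    0≤1/k! : 0# ≤ 1/ k !
    0≤1/k! = inverse-nonneg (ι-nonneg (k !)) (k!*1/k!≈1 k)
    power : ι (M ℕ.^ k) ≈ ι (L ℕ.^ k) * q ^ k
    power = begin
      ι (M ℕ.^ k)                                ≈⟨ *-identityʳ _ ⟨
      ι (M ℕ.^ k) * 1#                           ≈⟨ *-congˡ (ι4^*q^≈1 k) ⟨
      ι (M ℕ.^ k) * (ι (4 ℕ.^ k) * q ^ k)        ≈⟨ *-assoc _ _ _ ⟨
      ι (M ℕ.^ k) * ι (4 ℕ.^ k) * q ^ k          ≈⟨ *-congʳ (ι-* (M ℕ.^ k) (4 ℕ.^ k)) ⟨
      ι (M ℕ.^ k ℕ.* 4 ℕ.^ k) * q ^ k            ≈⟨ *-congʳ (reflexive (≡.cong ι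
          (≡.sym (^-distribʳ-* M 4 k)))) ⟩
      ι (L ℕ.^ k) * q ^ k                        ∎
    bound : 1/ k ! * ι (M ℕ.^ k) ≤ ι (L ℕ.^ L) * q ^ k
    bound = ≤-respˡ (*-congˡ (sym power)) (≤-respˡ (*-assoc _ _ _) (*-monoˡ-≤ (0≤q^ k) (≤-trans
      (*-monoʳ-≤ 0≤1/k! (ι-mono (power≤factorial L k)))
      (≤-reflexive (begin
        1/ k ! * ι (L ℕ.^ L ℕ.* k !)          ≈⟨ *-congˡ (ι-* (L ℕ.^ L) (k !)) ⟩
        1/ k ! * (ι (L ℕ.^ L) * ι (k !))      ≈⟨ solve 3 (λ c l f → c :* (l :* f) := l :* (f :* c))
            refl (1/ k !) (ι (L ℕ.^ L)) (ι (k !)) ⟩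
        ι (L ℕ.^ L) * (ι (k !) * 1/ k !)      ≈⟨ *-congˡ (k!*1/k!≈1 k) ⟩
        ι (L ℕ.^ L) * 1#                      ≈⟨ *-identityʳ _ ⟩
        ι (L ℕ.^ L)                           ∎)))))

  b : ℝ
  b = a + a

  abstract
    limit : ∃[ E ] ∀ k → Boundedᶜ (E -ᶜ Σ e k) (b * q ^ k)
    limit = (proj₁ re +i proj₁ im) , λ k → proj₂ re k , proj₂ im k
      where
      last-term : ∀ x y → y ≈ x + y - x
      last-term = solve 2 (λ x y → y := x :+ y :- x) refl
      re : ∃[ x ] ∀ k → Bounded (x - Re (Σ e k)) (b * q ^ k)
      re = geometric-limit (λ k → Re (Σ e k)) a λ k → Bounded-cong (last-term _ _)
          refl (proj₁ (e-bounded k))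
      im : ∃[ x ] ∀ k → Bounded (x - Im (Σ e k)) (b * q ^ k)
      im = geometric-limit (λ k → Im (Σ e k)) a λ k → Bounded-cong (last-term _ _)
          refl (proj₂ (e-bounded k))

  E : ℂ
  E = proj₁ limit

  E-bounded : ∀ k → Boundedᶜ (E -ᶜ Σ e k) (b * q ^ k)
  E-bounded = proj₂ limit

  0≤b : 0# ≤ b
  0≤b = +-nonneg 0≤a 0≤a
    where 0≤a = +-nonneg (ι-nonneg (L ℕ.^ L)) (ι-nonneg (L ℕ.^ L))

  -- Both coordinates are at most s ≤ δ/2, so 2 |w|² ≤ 4 s² ≤ δ². Equality of |w|² and δ² would make
  -- -δ² nonnegative, and scaling by δ⁻² then gives 0 ≤ -1.
  small⇒∣w∣²<δ² : ∀ {δ s w} → 0# <ʳ δ → 0# ≤ s → s + s ≤ δ → Boundedᶜ w s → ∣ w ∣² <ʳ δ * δ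
  small⇒∣w∣²<δ² {δ} {s} {w} (0≤δ , 0≉δ) 0≤s 2s≤δ (bx , by) =
    ≤-by (+-nonneg half 0≤∣w∣²)
      (solve 2 (λ E X → (E :- (X :+ X)) :+ X := E :- X) refl (δ * δ) ∣ w ∣²) ,
    λ X≈δ² → 0≰-1 (≤-respʳ (trans (*-congˡ (δ²-half X≈δ²)) δ⁻²) (*-nonneg (square-nonneg (δ ⁻¹)) half))
    where
    0≤∣w∣² = +-nonneg (square-nonneg (Re w)) (square-nonneg (Im w))
    half : 0# ≤ δ * δ - (∣ w ∣² + ∣ w ∣²)
    half = ≤-respʳ
      (solve 4 (λ δ s X Y → (δ :- (s :+ s)) :* (δ :+ (s :+ s)) :+
                   ((s :* s :- X :+ (s :* s :- Y)) :+ (s :* s :- X :+ (s :* s :- Y)))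
                 := δ :* δ :- ((X :+ Y) :+ (X :+ Y))) refl δ s (Re w * Re w) (Im w * Im w))
      (+-nonneg (*-nonneg (0≤y-x 2s≤δ) (+-nonneg 0≤δ (+-nonneg 0≤s 0≤s))) (+-nonneg squares squares))
      where squares = +-nonneg (0≤y-x (Bounded⇒square≤ bx)) (0≤y-x (Bounded⇒square≤ by))
    δ²-half : ∣ w ∣² ≈ δ * δ → δ * δ - (∣ w ∣² + ∣ w ∣²) ≈ - (δ * δ)
    δ²-half X≈δ² = trans (+-congˡ (-‿cong (+-cong X≈δ² X≈δ²)))
      (solve 1 (λ E → E :- (E :+ E) := :- E) refl (δ * δ))
    δ⁻² : δ ⁻¹ * δ ⁻¹ * - (δ * δ) ≈ - 1#
    δ⁻² = trans (solve 2 (λ i δ → i :* i :* (:- (δ :* δ)) := :- ((δ :* i) :* (δ :* i))) refl (δ ⁻¹) δ)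
      (-‿cong (trans (*-cong δi δi) (*-identityʳ 1#)))
      where δi = *-inverseʳ δ (0≉δ ∘ sym)

  E≈e^iθ : E ≈e^i θ
  E≈e^iθ δ δ>0@(0≤δ , 0≉δ) = N , λ k N≤k →
    ≡.subst (λ w → ∣ w -ᶜ E ∣² <ʳ δ * δ) (≡.sym (expSum≡Σ k))
      (small⇒∣w∣²<δ² δ>0 (*-nonneg 0≤b (0≤q^ k)) (tail≤δ k N≤k)
        (Boundedᶜ-neg (E-bounded k)))
    where
    δi≈1 = *-inverseʳ δ (0≉δ ∘ sym)
    -- For k ≥ N ≥ 2 b / δ the error satisfies 2 b q^k ≤ δ k q^k ≤ δ, as k ≤ 4^k.
    N = proj₁ (archimedean ((b + b) * δ ⁻¹))
    Boundedᶜ-neg : ∀ {w v r} → Boundedᶜ (w -ᶜ v) r → Boundedᶜ (v -ᶜ w) r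
    Boundedᶜ-neg (p , q) =
      Bounded-cong (flip _ _) refl (Bounded-neg p) , Bounded-cong (flip _ _) refl (Bounded-neg q)
      where flip = solve 2 (λ x y → :- (x :- y) := y :- x) refl
    tail≤δ : ∀ k → N ℕ.≤ k → b * q ^ k + b * q ^ k ≤ δ
    tail≤δ k N≤k = ≤-respˡ
      (trans (*-congʳ (trans (solve 3 (λ b i δ → δ :* (b :* i) := b :* (δ :* i))
          refl (b + b) (δ ⁻¹) δ) (trans (*-congˡ δi≈1) (*-identityʳ _))))
             (distribʳ (q ^ k) b b))
      (≤-trans
        (*-monoˡ-≤ (0≤q^ k) (*-monoʳ-≤ 0≤δ (≤-trans (proj₂ (archimedean ((b + b) * δ ⁻¹))) (ι-mono N≤k))))
        (≤-respˡ (sym (*-assoc _ _ _)) (≤-respʳ (*-identityʳ δ) (*-monoʳ-≤ 0≤δ (ι*q^≤1 k (k≤4^k k))))))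

  f : ℕ → ℂ
  f k = conj (e k)

  Σf≈conj-Σe : ∀ n → Σ f n ≈ᶜ conj (Σ e n)
  Σf≈conj-Σe zero    = refl , sym -0≈0
    where -0≈0 = solve 0 (:- :0 := :0) refl
  Σf≈conj-Σe (suc n) = ℂ-ring.trans (ℂ-ring.+-congʳ (Σf≈conj-Σe n)) (ℂ-ring.sym (conj-+ (Σ e n) (e n)))

  f-suc : ∀ k → κ (suc k) *ᶜ f (suc k) ≈ᶜ conj z *ᶜ f k
  f-suc k = ℂ-ring.trans (ℂ-ring.*-congʳ (ℂ-ring.sym conj-κ))
    (ℂ-ring.trans (ℂ-ring.sym (conj-* (κ (suc k)) (e (suc k))))
        (ℂ-ring.trans (conj-cong (e-suc k)) (conj-* z (e k))))
    where
    conj-κ : conj (κ (suc k)) ≈ᶜ κ (suc k)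
    conj-κ = refl , trans (-‿cong (proj₂ (κ≈ι (suc k))))
      (trans (solve 0 (:- :0 := :0) refl) (sym (proj₂ (κ≈ι (suc k)))))

  conv-e-f-0 : conv e f 0 ≈ᶜ 1ᶜ
  conv-e-f-0 = ℂ-ring.trans (ℂ-ring.*-cong e0≈1 (conj-cong e0≈1))
    (solve 0 (:1 :* :1 :- :0 :* (:- :0) := :1) refl ,
     solve 0 (:1 :* (:- :0) :+ :0 :* :1 := :0) refl)
    where
    1/0!≈1 : 1/ 0 ! ≈ 1#
    1/0!≈1 = trans (solve 1 (λ c → c := (:1 :+ :0) :* c) refl (1/ 0 !)) (k!*1/k!≈1 0)
    e0≈1 : e 0 ≈ᶜ 1ᶜ
    e0≈1 = ℂ-ring.trans (ℂ-ring.*-identityʳ _) (1/0!≈1 , refl)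

  -- The exponents iθ and -iθ add up to 0, so the recursion of `conv-exponential` annihilates every
  -- coefficient after the constant one.
  conv-e-f-suc : ∀ n → conv e f (suc n) ≈ᶜ 0ᶜ
  conv-e-f-suc n = κ-cancel n (ℂ-ring.trans (conv-exponential e-suc f-suc n)
    (ℂ-ring.trans (ℂ-ring.*-congʳ z+conj-z≈0) (ℂ-ring.zeroˡ _)))
    where
    z+conj-z≈0 : z +ᶜ conj z ≈ᶜ 0ᶜ
    z+conj-z≈0 = +-identityʳ 0# , -‿inverseʳ θ

  Σ-conv-e-f : ∀ n → Σ (conv e f) (suc n) ≈ᶜ 1ᶜ
  Σ-conv-e-f zero    = ℂ-ring.trans (ℂ-ring.+-identityˡ _) conv-e-f-0
  Σ-conv-e-f (suc n) = ℂ-ring.trans (ℂ-ring.+-cong (Σ-conv-e-f n) (conv-e-f-suc n))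
      (ℂ-ring.+-identityʳ _)

  conj-E-bounded : ∀ k → Boundedᶜ (conj E -ᶜ Σ f k) (b * q ^ k)
  conj-E-bounded k = Boundedᶜ-cong
    (refl′ , trans (solve 2 (λ x y → :- (x :- y) := :- x :- (:- y))
        refl (Im E) (Im (Σ e k))) (+-congˡ (-‿cong (sym (proj₂ (Σf≈conj-Σe k))))))
    refl (Boundedᶜ-conj (E-bounded k))
    where refl′ = +-congˡ (-‿cong (sym (proj₁ (Σf≈conj-Σe k))))

  -- With S = `Σ e (suc k)`, the number E Ē - 1 is (E - S) Ē + (S Ē - 1). The summands are bounded
  -- by 2 b² q^(k+1) and (k + 1) 2 a b q^(k+1); `K` is what remains after (k + 1) q^k is taken out
  -- of the sum, the first bound being enlarged by the factor k + 1.
  K : ℝ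
  K = q * ((a * b + a * b) + (b * b + b * b))

  E*conj-E-1-bounded : ∀ k → Boundedᶜ (E *ᶜ conj E -ᶜ 1ᶜ) (ι (suc k) * K * q ^ k)
  E*conj-E-1-bounded k = Boundedᶜ-weaken
    (≤-by (*-nonneg (ι-nonneg k) (*-nonneg (+-nonneg (*-nonneg 0≤b 0≤b)
        (*-nonneg 0≤b 0≤b)) (0≤q^ (suc k))))
      (solve 5 (λ a b q p n → n :* ((b :* b :+ b :* b) :* (q :* p)) :=
        (:1 :+ n) :* (q :* ((a :* b :+ a :* b) :+ (b :* b :+ b :* b))) :* p :-
        (((b :* (q :* p)) :* (b :* :1) :+ (b :* (q :* p)) :* (b :* :1)) :+
         (:1 :+ n) :* (a :* b :+ a :* b) :* (q :* p))) refl a b q (q ^ k) (ι k)))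
    (Boundedᶜ-cong
      (ℂ-ring.trans (ℂ-ring.+-congˡ (ℂ-ring.+-congˡ (ℂ-ring.-‿cong (Σ-conv-e-f k))))
        (solveᶜ 3 (λ E F S → (E ⊝ S) ⊗ F ⊕ (S ⊗ F ⊝ :1ᶜ) ⊜ E ⊗ F ⊝ :1ᶜ)
            ℂ-ring.refl E (conj E) (Σ e (suc k))))
      refl
      -- The bound on Ē itself is the error bound at index 0, where the partial sum is empty.
      (Boundedᶜ-+ (Boundedᶜ-* (E-bounded (suc k)) (Boundedᶜ-cong (solveᶜ 1 (λ F → F ⊝ :0ᶜ ⊜ F)
          ℂ-ring.refl (conj E)) refl (conj-E-bounded 0)))
                  (cauchy-remainder-bound e-bounded conj-E-bounded (suc k))))

  E∈𝕋 : 𝕋 E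
  E∈𝕋 = trans (sym (proj₁ (z*conj-z E))) (≤-antisym
      (x-y≤0⇒x≤y (linear*q^-bounded⇒≤0 0≤K (λ k → r-x≥0⇒x≤r (proj₂ (proj₁ (E*conj-E-1-bounded k))))))
      (y-x≤0⇒y≤x (linear*q^-bounded⇒≤0 0≤K (λ k → r-x≥0⇒x≤r (proj₂
          (Bounded-neg (proj₁ (E*conj-E-1-bounded k))))))))
    where
    0≤a = +-nonneg (ι-nonneg (L ℕ.^ L)) (ι-nonneg (L ℕ.^ L))
    0≤K = *-nonneg 0≤q (+-nonneg (+-nonneg (*-nonneg 0≤a 0≤b) (*-nonneg 0≤a 0≤b))
        (+-nonneg (*-nonneg 0≤b 0≤b) (*-nonneg 0≤b 0≤b)))
    r-x≥0⇒x≤r : ∀ {x r} → 0# ≤ r - x → x ≤ r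
    r-x≥0⇒x≤r p = ≤-by p refl
    x-y≤0⇒x≤y : ∀ {x y} → x - y ≤ 0# → x ≤ y
    x-y≤0⇒x≤y {x} {y} p = ≤-by (0≤-x p) (solve 2 (λ x y → :- (x :- y) := y :- x) refl x y)
    y-x≤0⇒y≤x : ∀ {x y} → - (x - y) ≤ 0# → y ≤ x
    y-x≤0⇒y≤x {x} {y} p = ≤-by (0≤-x p) (solve 2 (λ x y → :- (:- (x :- y)) := x :- y) refl x y)

-- Gains on K₄

hamiltonianPath : Subset 6
hamiltonianPath = inside ∷ outside ∷ outside ∷ inside ∷ outside ∷ inside ∷ []

-- Tabulated, so that the gain of a tree path evaluates to an explicit product of edge gains.
pathWalk : ∀ u v → Walk K₄ hamiltonianPath u v
pathWalk = λ
  { 0F 0F → ε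
  ; 0F 1F → 0→1 ◅ ε
  ; 0F 2F → 0→1 ◅ 1→2 ◅ ε
  ; 0F 3F → 0→1 ◅ 1→2 ◅ 2→3 ◅ ε
  ; 1F 0F → 1→0 ◅ ε
  ; 1F 1F → ε
  ; 1F 2F → 1→2 ◅ ε
  ; 1F 3F → 1→2 ◅ 2→3 ◅ ε
  ; 2F 0F → 2→1 ◅ 1→0 ◅ ε
  ; 2F 1F → 2→1 ◅ ε
  ; 2F 2F → ε
  ; 2F 3F → 2→3 ◅ ε
  ; 3F 0F → 3→2 ◅ 2→1 ◅ 1→0 ◅ ε
  ; 3F 1F → 3→2 ◅ 2→1 ◅ ε
  ; 3F 2F → 3→2 ◅ ε
  ; 3F 3F → ε
  }
  where
  0→1 : Step K₄ hamiltonianPath 0F 1F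
  0→1 = 0F , here , inj₁ ≡.refl
  1→2 : Step K₄ hamiltonianPath 1F 2F
  1→2 = 3F , there (there (there here)) , inj₁ ≡.refl
  2→3 : Step K₄ hamiltonianPath 2F 3F
  2→3 = 5F , there (there (there (there (there here)))) , inj₁ ≡.refl
  1→0 = Step-sym {K₄} 0→1
  2→1 = Step-sym {K₄} 1→2
  3→2 = Step-sym {K₄} 2→3

hamiltonianPath-path : ∀ u v → Path K₄ hamiltonianPath u v
hamiltonianPath-path u v = pathWalk u v ,
  toWitness {a? = all? λ u → all? λ v → unique? _≟ᶠ_ (vertices K₄ (pathWalk u v))} _ u v

-- `r` numbers the vertices along the Hamiltonian path from either end: `toℕ` serves for walks that
-- start upwards and `toℕ ∘ opposite` for those that start downwards.
Consecutive : (Fin 4 → ℕ) → Fin 4 → Fin 4 → Set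
Consecutive r u v = r v ≡ suc (r u) ⊎ r u ≡ suc (r v)

module _ {H : Subset 6} (r : Fin 4 → ℕ) (r-injective : Injective _≡_ _≡_ r)
         (consecutive : ∀ {u v} → Step K₄ H u v → Consecutive r u v) where

  -- A path cannot turn back, so it keeps climbing once it has started to climb.
  climb : ∀ {u v w} → r v ≡ suc (r u) → (p : Walk K₄ H v w) → Unique (u ∷ vertices K₄ p) →
          r w ≡ r u ℕ.+ length (vertices K₄ p)
  climb {u} up ε _ = ≡.trans up (ℕ.+-comm 1 (r u))
  climb {u} up (s ◅ p) ((_ ∷ u∉p) ∷ p!) with consecutive s
  ... | inj₁ up′  = ≡.trans (climb up′ p p!) (≡.trans (≡.cong (ℕ._+ _) up) (≡.sym (ℕ.+-suc (r u) _)))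
  ... | inj₂ down = contradiction (r-injective (ℕ.suc-injective (≡.trans (≡.sym up) down)))
                                  (All.lookup u∉p (start∈vertices p))

  -- The climb ends at least two levels above `u`, whereas a single closing step changes the level
  -- by one.
  no-cycle-from-climb : ∀ {u v w} → r v ≡ suc (r u) → (p : Walk K₄ H v w) →
                        Unique (u ∷ vertices K₄ p) → 2 ℕ.≤ length (vertices K₄ p) → ¬ Step K₄ H w u
  no-cycle-from-climb {u} up p p! 2≤∣p∣ back
    with ℕ.≤-trans (ℕ.+-monoʳ-≤ (r u) 2≤∣p∣) (ℕ.≤-reflexive (≡.sym (climb up p p!)))
       | consecutive back
  ... | 2+ru≤rw | inj₁ ru≡1+rw = ℕ.<⇒≱ (ℕ.≤-reflexive (≡.sym ru≡1+rw))
    (ℕ.≤-trans (ℕ.m≤m+n (r u) 2) 2+ru≤rw)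
  ... | 2+ru≤rw | inj₂ rw≡1+ru = ℕ.<⇒≱ (ℕ.≤-reflexive (ℕ.+-comm 2 (r u)))
    (ℕ.≤-trans 2+ru≤rw (ℕ.≤-reflexive rw≡1+ru))

hamiltonianPath-consecutive : ∀ {u v} → Step K₄ hamiltonianPath u v → Consecutive toℕ u v
hamiltonianPath-consecutive (0F , _ , inj₁ ≡.refl) = inj₁ ≡.refl
hamiltonianPath-consecutive (0F , _ , inj₂ ≡.refl) = inj₂ ≡.refl
hamiltonianPath-consecutive (1F , there () , _)
hamiltonianPath-consecutive (2F , there (there ()) , _)
hamiltonianPath-consecutive (3F , _ , inj₁ ≡.refl) = inj₁ ≡.refl
hamiltonianPath-consecutive (3F , _ , inj₂ ≡.refl) = inj₂ ≡.refl
hamiltonianPath-consecutive (4F , there (there (there (there ()))) , _)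
hamiltonianPath-consecutive (5F , _ , inj₁ ≡.refl) = inj₁ ≡.refl
hamiltonianPath-consecutive (5F , _ , inj₂ ≡.refl) = inj₂ ≡.refl

opposite-suc : ∀ (u v : Fin 4) → toℕ u ≡ suc (toℕ v) → toℕ (opposite v) ≡ suc (toℕ (opposite u))
opposite-suc = toWitness {a? = all? λ u → all? λ v →
  (toℕ u ℕ.≟ suc (toℕ v)) →-dec (toℕ (opposite v) ℕ.≟ suc (toℕ (opposite u)))} _

opposite-injective : ∀ {n} → Injective _≡_ _≡_ (opposite {n})
opposite-injective {_} {i} {j} eq =
  ≡.trans (≡.sym (opposite-involutive i)) (≡.trans (≡.cong opposite eq) (opposite-involutive j))

hamiltonianPath-acyclic : Acyclic K₄ hamiltonianPath
hamiltonianPath-acyclic (ε , _) (s≤s ())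
hamiltonianPath-acyclic (s ◅ p , p!) (s≤s 2≤∣p∣) with hamiltonianPath-consecutive s
... | inj₁ up   = no-cycle-from-climb toℕ toℕ-injective hamiltonianPath-consecutive up p p! 2≤∣p∣
... | inj₂ down = no-cycle-from-climb (toℕ ∘ opposite) (opposite-injective ∘ toℕ-injective)
  (Sum.swap ∘ Sum.map (opposite-suc _ _) (opposite-suc _ _) ∘ hamiltonianPath-consecutive)
  (opposite-suc _ _ down) p p! 2≤∣p∣

hamiltonianTree : NormalSpanningTree K₄
hamiltonianTree = record
  { T       = hamiltonianPath
  ; path    = hamiltonianPath-path
  ; acyclic = hamiltonianPath-acyclic
  ; root    = 0F
  -- A path rooted at its end has a total tree order, so all pairs are comparable, which is checked
  -- by evaluation.
  ; normal  = λ u v _ → toWitness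
      {a? = all? λ u → all? λ v → (u ∈ˡ? ancestors v) ⊎-dec (v ∈ˡ? ancestors u)} _ u v
  }
  where
  open DecMembership _≟ᶠ_ using () renaming (_∈?_ to _∈ˡ?_)
  ancestors = λ v → vertices K₄ (pathWalk 0F v)

K₄-connected : Connected K₄
K₄-connected u v = let p , p! = hamiltonianPath-path u v in
  walk-⊆ ⊆⊤ p , ≡.subst Unique (≡.sym (vertices-walk-⊆ ⊆⊤ p)) p!

-- Gains with nonnegative real parts

module Gains (𝓡 : RealNumbers) where
  open RealNumbers 𝓡
  open RealAnalysis 𝓡
  open Complex 𝓡
  open ComplexNumbers 𝓡
  open IntegerRingSolver commutativeRing using (solve; _:=_; _:+_; _:*_; _:-_; :-_; :0; :1)
  open IntegerRingSolver ℂ-commutativeRing using ()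
    renaming (solve to solveᶜ; _:=_ to _⊜_; _:*_ to _⊗_; :1 to :1ᶜ)
  open SetoidReasoning ℂ-ring.setoid

  sign : ∀ x → ∃[ σ ] (σ * σ ≈ 1# × 0# ≤ σ * x)
  sign x with total 0# x
  ... | inj₁ 0≤x = 1# , *-identityʳ 1# , ≤-respʳ (sym (*-identityˡ x)) 0≤x
  ... | inj₂ x≤0 = - 1# , solve 0 ((:- :1) :* (:- :1) := :1) refl ,
    ≤-respʳ (solve 1 (λ x → :- x := (:- :1) :* x) refl x) (0≤-x x≤0)

  Unimodular : ℂ → Set
  Unimodular z = z *ᶜ conj z ≈ᶜ 1ᶜ

  unimodular-* : ∀ {z w} → Unimodular z → Unimodular w → Unimodular (z *ᶜ w)
  unimodular-* {z} {w} uz uw = begin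
    z *ᶜ w *ᶜ conj (z *ᶜ w)            ≈⟨ ℂ-ring.*-congˡ (conj-* z w) ⟩
    z *ᶜ w *ᶜ (conj z *ᶜ conj w)       ≈⟨ solveᶜ 4 (λ a b c d → a ⊗ b ⊗ (c ⊗ d) ⊜ (a ⊗ c) ⊗ (b ⊗ d))
        ℂ-ring.refl z w (conj z) (conj w) ⟩
    (z *ᶜ conj z) *ᶜ (w *ᶜ conj w)     ≈⟨ ℂ-ring.*-cong uz uw ⟩
    1ᶜ *ᶜ 1ᶜ                           ≈⟨ ℂ-ring.*-identityʳ 1ᶜ ⟩
    1ᶜ                                 ∎

  unimodular-conj : ∀ {z} → Unimodular z → Unimodular (conj z)
  unimodular-conj {z} uz =
    ℂ-ring.trans (ℂ-ring.*-congˡ (conj-involutive z)) (ℂ-ring.trans (ℂ-ring.*-comm (conj z) z) uz)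

  i : ℂ
  i = 0# +i 1#

  unimodular-i : Unimodular i
  unimodular-i = solve 0 (:0 :* :0 :- :1 :* (:- :1) := :1) refl ,
                 solve 0 (:0 :* (:- :1) :+ :1 :* :0 := :0) refl

  -- A sign ± 1 is given as a real unimodular complex number, so that it enters products and
  -- conjugates like any gain.
  record Sign (u : ℂ) : Set where
    field
      s          : ℂ
      real       : Im s ≈ 0#
      unimodular : Unimodular s
      nonneg     : 0# ≤ Re (s *ᶜ u)

    selfadjoint : conj s ≈ᶜ s
    selfadjoint = refl , trans (-‿cong real)
      (trans (solve 0 (:- :0 := :0) refl) (sym real))

  chooseSign : ∀ u → Sign u
  chooseSign (a +i b) with sign a
  ... | σ , σσ≈1 , 0≤σa = record
    { s          = σ +i 0#
    ; real       = refl
    ; unimodular =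
        trans (solve 1 (λ σ → σ :* σ :- :0 :* (:- :0) := σ :* σ) refl σ) σσ≈1 ,
        solve 1 (λ σ → σ :* (:- :0) :+ :0 :* σ := :0) refl σ
    ; nonneg     = ≤-respʳ (solve 3 (λ σ a b → σ :* a := σ :* a :- :0 :* b) refl σ a b) 0≤σa
    }

  0≤Re-real*i : ∀ {w} → Im w ≈ 0# → 0# ≤ Re (w *ᶜ i)
  0≤Re-real*i {a +i b} b≈0 = ≤-reflexive (trans (sym b≈0-)
    (solve 2 (λ a b → :- b := a :* :0 :- b :* :1) refl a b))
    where b≈0- = trans (-‿cong b≈0) (solve 0 (:- :0 := :0) refl)

  0≤Re-real*conj-i : ∀ {w} → Im w ≈ 0# → 0# ≤ Re (w *ᶜ conj i)
  0≤Re-real*conj-i {a +i b} b≈0 = ≤-reflexive (trans (sym b≈0)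
    (solve 2 (λ a b → b := a :* :0 :- b :* (:- :1)) refl a b))

  real-* : ∀ {w v} → Im w ≈ 0# → Im v ≈ 0# → Im (w *ᶜ v) ≈ 0#
  real-* {a +i b} {c +i d} b≈0 d≈0 = trans (+-cong (*-congˡ d≈0) (*-congʳ b≈0))
    (solve 2 (λ a c → a :* :0 :+ :0 :* c := :0) refl a c)

  module Balanced {A B C : ℂ} (uA : Unimodular A) (uB : Unimodular B) (uC : Unimodular C) where
    module S₁ = Sign (chooseSign (C *ᶜ conj B))
    x = S₁.s *ᶜ (C *ᶜ conj B)
    -- `i` stands for the `y` whose sign is being chosen; a real sign passes through the conjugation
    -- unchanged.
    module S₂ = Sign (chooseSign (A *ᶜ conj (x *ᶜ i)))
    y = S₂.s *ᶜ i
    xy = x *ᶜ y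
    module S₃ = Sign (chooseSign (i *ᶜ (C *ᶜ conj xy)))
    z = S₃.s *ᶜ (i *ᶜ (C *ᶜ conj xy))
    yz = y *ᶜ z
    xyz = xy *ᶜ z

    unimodular-x : Unimodular x
    unimodular-x = unimodular-* S₁.unimodular (unimodular-* uC (unimodular-conj uB))
    unimodular-y : Unimodular y
    unimodular-y = unimodular-* S₂.unimodular unimodular-i
    unimodular-xy : Unimodular xy
    unimodular-xy = unimodular-* unimodular-x unimodular-y
    unimodular-z : Unimodular z
    unimodular-z = unimodular-* S₃.unimodular
      (unimodular-* unimodular-i (unimodular-* uC (unimodular-conj unimodular-xy)))
    unimodular-yz : Unimodular yz
    unimodular-yz = unimodular-* unimodular-y unimodular-z
    unimodular-xyz : Unimodular xyz
    unimodular-xyz = unimodular-* unimodular-xy unimodular-z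

    conj-z : conj z ≈ᶜ S₃.s *ᶜ (conj i *ᶜ (conj C *ᶜ xy))
    conj-z = begin
      conj (S₃.s *ᶜ (i *ᶜ (C *ᶜ conj xy)))
        ≈⟨ conj-* _ _ ⟩
      conj S₃.s *ᶜ conj (i *ᶜ (C *ᶜ conj xy))
        ≈⟨ ℂ-ring.*-cong S₃.selfadjoint (conj-* _ _) ⟩
      S₃.s *ᶜ (conj i *ᶜ conj (C *ᶜ conj xy))
        ≈⟨ ℂ-ring.*-congˡ (ℂ-ring.*-congˡ (ℂ-ring.trans (conj-* C (conj xy))
            (ℂ-ring.*-congˡ (conj-involutive xy)))) ⟩
      S₃.s *ᶜ (conj i *ᶜ (conj C *ᶜ xy)) ∎

    0≤Re-A : 0# ≤ Re (A *ᶜ conj xy)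
    0≤Re-A = ≤-respʳ (proj₁ (begin
      S₂.s *ᶜ (A *ᶜ conj (x *ᶜ i))
        ≈⟨ ℂ-ring.*-congˡ (ℂ-ring.*-congˡ (conj-* x i)) ⟩
      S₂.s *ᶜ (A *ᶜ (conj x *ᶜ conj i))
        ≈⟨ solveᶜ 4 (λ s a x i → s ⊗ (a ⊗ (x ⊗ i)) ⊜ a ⊗ (x ⊗ (s ⊗ i)))
            ℂ-ring.refl S₂.s A (conj x) (conj i) ⟩
      A *ᶜ (conj x *ᶜ (S₂.s *ᶜ conj i))
        ≈⟨ ℂ-ring.*-congˡ (ℂ-ring.*-congˡ (ℂ-ring.*-congʳ S₂.selfadjoint)) ⟨
      A *ᶜ (conj x *ᶜ (conj S₂.s *ᶜ conj i))
        ≈⟨ ℂ-ring.*-congˡ (ℂ-ring.*-congˡ (conj-* S₂.s i)) ⟨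
      A *ᶜ (conj x *ᶜ conj y)
        ≈⟨ ℂ-ring.*-congˡ (conj-* x y) ⟨
      A *ᶜ conj xy ∎)) S₂.nonneg

    -- `conj z` contains `conj C` and `xy`, hence also `y`, `C` and `conj B`. With `B` and `conj y`
    -- all of these cancel, leaving two signs times `conj i`.
    0≤Re-B : 0# ≤ Re (B *ᶜ conj yz)
    0≤Re-B = ≤-respʳ (sym (proj₁ (begin
      B *ᶜ conj yz
        ≈⟨ ℂ-ring.*-congˡ (ℂ-ring.trans (conj-* y z) (ℂ-ring.*-congˡ conj-z)) ⟩
      B *ᶜ (conj y *ᶜ (S₃.s *ᶜ (conj i *ᶜ (conj C *ᶜ (S₁.s *ᶜ (C *ᶜ conj B) *ᶜ y)))))
        ≈⟨ solveᶜ 9 (λ b b′ c c′ y y′ s t i → b ⊗ (y′ ⊗ (t ⊗ (i ⊗ (c′ ⊗ (s ⊗ (c ⊗ b′) ⊗ y))))) ⊜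
             ((b ⊗ b′) ⊗ ((c ⊗ c′) ⊗ (y ⊗ y′))) ⊗ ((t ⊗ s) ⊗ i)) ℂ-ring.refl
             B (conj B) C (conj C) y (conj y) S₁.s S₃.s (conj i) ⟩
      ((B *ᶜ conj B) *ᶜ ((C *ᶜ conj C) *ᶜ (y *ᶜ conj y))) *ᶜ ((S₃.s *ᶜ S₁.s) *ᶜ conj i)
        ≈⟨ ℂ-ring.*-congʳ (ℂ-ring.*-cong uB (ℂ-ring.*-cong uC unimodular-y)) ⟩
      (1ᶜ *ᶜ (1ᶜ *ᶜ 1ᶜ)) *ᶜ ((S₃.s *ᶜ S₁.s) *ᶜ conj i)
        ≈⟨ solveᶜ 1 (λ w → (:1ᶜ ⊗ (:1ᶜ ⊗ :1ᶜ)) ⊗ w ⊜ w) ℂ-ring.refl _ ⟩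
      (S₃.s *ᶜ S₁.s) *ᶜ conj i ∎)))
      (0≤Re-real*conj-i (real-* S₃.real S₁.real))

    0≤Re-C : 0# ≤ Re (C *ᶜ conj xyz)
    0≤Re-C = ≤-respʳ (sym (proj₁ (begin
      C *ᶜ conj xyz
        ≈⟨ ℂ-ring.*-congˡ (ℂ-ring.trans (conj-* xy z) (ℂ-ring.*-congˡ conj-z)) ⟩
      C *ᶜ (conj xy *ᶜ (S₃.s *ᶜ (conj i *ᶜ (conj C *ᶜ xy))))
        ≈⟨ solveᶜ 6 (λ c c′ p p′ t i → c ⊗ (p′ ⊗ (t ⊗ (i ⊗ (c′ ⊗ p)))) ⊜
            ((c ⊗ c′) ⊗ (p ⊗ p′)) ⊗ (t ⊗ i)) ℂ-ring.refl
             C (conj C) xy (conj xy) S₃.s (conj i) ⟩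
      ((C *ᶜ conj C) *ᶜ (xy *ᶜ conj xy)) *ᶜ (S₃.s *ᶜ conj i)
        ≈⟨ ℂ-ring.*-congʳ (ℂ-ring.*-cong uC unimodular-xy) ⟩
      (1ᶜ *ᶜ 1ᶜ) *ᶜ (S₃.s *ᶜ conj i)
        ≈⟨ solveᶜ 1 (λ w → (:1ᶜ ⊗ :1ᶜ) ⊗ w ⊜ w) ℂ-ring.refl _ ⟩
      S₃.s *ᶜ conj i ∎)))
      (0≤Re-real*conj-i S₃.real)

    -- The gains of the edges of the suitably oriented graph.
    h : Fin 6 → ℂ
    h 0F = x
    h 1F = A *ᶜ conj xy
    h 2F = C *ᶜ conj xyz
    h 3F = y
    h 4F = B *ᶜ conj yz
    h 5F = z

    h-unimodular : ∀ e → Unimodular (h e)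
    h-unimodular 0F = unimodular-x
    h-unimodular 1F = unimodular-* uA (unimodular-conj unimodular-xy)
    h-unimodular 2F = unimodular-* uC (unimodular-conj unimodular-xyz)
    h-unimodular 3F = unimodular-y
    h-unimodular 4F = unimodular-* uB (unimodular-conj unimodular-yz)
    h-unimodular 5F = unimodular-z

    0≤Re-h : ∀ e → 0# ≤ Re (h e)
    0≤Re-h 0F = S₁.nonneg
    0≤Re-h 1F = 0≤Re-A
    0≤Re-h 2F = 0≤Re-C
    0≤Re-h 3F = 0≤Re-real*i S₂.real
    0≤Re-h 4F = 0≤Re-B
    0≤Re-h 5F = S₃.nonneg

    φ : Fin 4 → Fin 4 → ℂ
    φ 0F 0F = 1ᶜ
    φ 0F 1F = h 0F
    φ 0F 2F = conj (h 1F)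
    φ 0F 3F = conj (h 2F)
    φ 1F 0F = conj (h 0F)
    φ 1F 1F = 1ᶜ
    φ 1F 2F = h 3F
    φ 1F 3F = conj (h 4F)
    φ 2F 0F = h 1F
    φ 2F 1F = conj (h 3F)
    φ 2F 2F = 1ᶜ
    φ 2F 3F = h 5F
    φ 3F 0F = h 2F
    φ 3F 1F = h 4F
    φ 3F 2F = conj (h 5F)
    φ 3F 3F = 1ᶜ

    -- The sixteen entries reduce to three cases. The diagonal, which carries no edge, is filled
    -- with 1 so that unimodularity and inverses hold there too.
    φ-elim : (P : ℂ → ℂ → Set) → P 1ᶜ 1ᶜ → (∀ e → P (h e) (conj (h e))) →
             (∀ e → P (conj (h e)) (h e)) → ∀ u v → P (φ u v) (φ v u)
    φ-elim P d f b = λ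
      { 0F 0F → d    ; 0F 1F → f 0F ; 0F 2F → b 1F ; 0F 3F → b 2F
      ; 1F 0F → b 0F ; 1F 1F → d    ; 1F 2F → f 3F ; 1F 3F → b 4F
      ; 2F 0F → f 1F ; 2F 1F → b 3F ; 2F 2F → d    ; 2F 3F → f 5F
      ; 3F 0F → f 2F ; 3F 1F → f 4F ; 3F 2F → b 5F ; 3F 3F → d
      }

    gain : Gain 𝓡 K₄
    gain = record
      { φ       = φ
      ; unit    = λ {u} {v} _ → φ-elim (λ w _ → 𝕋 w) (z*conj-z≈1⇒𝕋 {1ᶜ} unimodular-1)
          (λ e → z*conj-z≈1⇒𝕋 {h e} (h-unimodular e))
          (λ e → z*conj-z≈1⇒𝕋 {conj (h e)} (unimodular-conj (h-unimodular e))) u v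
      ; inverse = λ {u} {v} _ → φ-elim (λ w w′ → w′ *ᶜ w ≈ᶜ 1ᶜ) (ℂ-ring.*-identityʳ 1ᶜ)
          (λ e → ℂ-ring.trans (ℂ-ring.*-comm _ _) (h-unimodular e)) h-unimodular u v
      }
      where
      unimodular-1 : Unimodular 1ᶜ
      unimodular-1 = solve 0 (:1 :* :1 :- :0 :* (:- :0) := :1) refl ,
                     solve 0 (:1 :* (:- :0) :+ :0 :* :1 := :0) refl

    0≤Re-adjacencyMatrix : ∀ u v → 0# ≤ Re (adjacencyMatrix 𝓡 gain u v)
    0≤Re-adjacencyMatrix u v with does (u ∼? v)
    ... | true  = φ-elim (λ w _ → 0# ≤ Re w) 0≤1 0≤Re-h 0≤Re-h u v
    ... | false = ≤-refl

    cycle-gain : ∀ {w p} D → Unimodular p → w ≈ᶜ p → D ≈ᶜ w *ᶜ (D *ᶜ conj p)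
    cycle-gain {w} {p} D up w≈p = ℂ-ring.sym (begin
      w *ᶜ (D *ᶜ conj p)     ≈⟨ ℂ-ring.*-congʳ w≈p ⟩
      p *ᶜ (D *ᶜ conj p)     ≈⟨ solveᶜ 3 (λ p d p′ → p ⊗ (d ⊗ p′) ⊜ d ⊗ (p ⊗ p′))
          ℂ-ring.refl p D (conj p) ⟩
      D *ᶜ (p *ᶜ conj p)     ≈⟨ ℂ-ring.*-congˡ up ⟩
      D *ᶜ 1ᶜ                ≈⟨ ℂ-ring.*-identityʳ D ⟩
      D                      ∎)

    A-cycle : A ≈ᶜ (x *ᶜ (y *ᶜ 1ᶜ)) *ᶜ h 1F
    A-cycle = cycle-gain A unimodular-xy (ℂ-ring.*-congˡ (ℂ-ring.*-identityʳ y))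
    B-cycle : B ≈ᶜ (y *ᶜ (z *ᶜ 1ᶜ)) *ᶜ h 4F
    B-cycle = cycle-gain B unimodular-yz (ℂ-ring.*-congˡ (ℂ-ring.*-identityʳ z))
    C-cycle : C ≈ᶜ (x *ᶜ (y *ᶜ (z *ᶜ 1ᶜ))) *ᶜ h 2F
    C-cycle = cycle-gain C unimodular-xyz (ℂ-ring.trans
      (ℂ-ring.*-congˡ (ℂ-ring.*-congˡ (ℂ-ring.*-identityʳ z))) (ℂ-ring.sym (ℂ-ring.*-assoc x y z)))

  <-respˡ : ∀ {u v w} → u ≈ v → u <ʳ w → v <ʳ w
  <-respˡ u≈v (u≤w , u≉w) = ≤-respˡ u≈v u≤w , u≉w ∘ trans u≈v

  ≈e^i-cong : ∀ {z w θ} → z ≈ᶜ w → z ≈e^i θ → w ≈e^i θ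
  ≈e^i-cong (p , q) limit δ 0<δ = let N , close = limit δ 0<δ in
    N , λ k N≤k → <-respˡ (+-cong (*-cong (re k) (re k)) (*-cong (im k) (im k))) (close k N≤k)
    where
    re = λ k → +-congˡ (-‿cong p)
    im = λ k → +-congˡ (-‿cong q)

  hamiltonianTree-GNRP : GNRP 𝓡 hamiltonianTree
  hamiltonianTree-GNRP r _ = gain , cycles-gains , 0≤Re-adjacencyMatrix
    where
    module E₁ = Exponential 𝓡 (r 1F)
    module E₂ = Exponential 𝓡 (r 2F)
    module E₄ = Exponential 𝓡 (r 4F)
    -- The edges v₀v₂, v₁v₃ and v₀v₃ belonging to A, B and C have the indices 1, 4 and 2.
    open Balanced (𝕋⇒z*conj-z≈1 {E₁.E} E₁.E∈𝕋) (𝕋⇒z*conj-z≈1 {E₄.E} E₄.E∈𝕋)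
                  (𝕋⇒z*conj-z≈1 {E₂.E} E₂.E∈𝕋)
    cycles-gains : _∈𝒜_ 𝓡 hamiltonianTree gain r
    cycles-gains 0F e∉T = contradiction here e∉T
    cycles-gains 3F e∉T = contradiction (there (there (there here))) e∉T
    cycles-gains 5F e∉T = contradiction (there (there (there (there (there here))))) e∉T
    cycles-gains 1F _ _ _ (inj₁ ≡.refl) _ = ≈e^i-cong A-cycle E₁.E≈e^iθ
    cycles-gains 2F _ _ _ (inj₁ ≡.refl) _ = ≈e^i-cong C-cycle E₂.E≈e^iθ
    cycles-gains 4F _ _ _ (inj₁ ≡.refl) _ = ≈e^i-cong B-cycle E₄.E≈e^iθ
    -- In the reversed orientation the upper end would have to lie on the path from the root to the
    -- lower end.
    cycles-gains 1F _ _ _ (inj₂ ≡.refl) (here ())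
    cycles-gains 1F _ _ _ (inj₂ ≡.refl) (there ())
    cycles-gains 2F _ _ _ (inj₂ ≡.refl) (here ())
    cycles-gains 2F _ _ _ (inj₂ ≡.refl) (there ())
    cycles-gains 4F _ _ _ (inj₂ ≡.refl) (here ())
    cycles-gains 4F _ _ _ (inj₂ ≡.refl) (there (here ()))
    cycles-gains 4F _ _ _ (inj₂ ≡.refl) (there (there ()))

K₄∈𝒫 : (𝓡 : RealNumbers) → 𝒫 𝓡 K₄
K₄∈𝒫 𝓡 = K₄-connected , hamiltonianTree , Gains.hamiltonianTree-GNRP 𝓡

theorem4p3 : (¬ 𝔉 K₄) × ((𝓡 : RealNumbers) → 𝒫 𝓡 K₄)
theorem4p3 = K₄∉𝔉 , K₄∈𝒫
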